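{- (Decidability) The model-checking game for finite systems against TFL specifications is decidable: given a finite system $\mathfrak T$, a valuation $\mathcal V$ and a TFL formula $\phi$ in positive normal form, it is decidable which player has a winning strategy in $\mathcal G(H_0,\phi)$, where $H_0=(\mathfrak X(s_0),t_\epsilon)$.
   Context: Systems: $\mathfrak T=(S,s_0,T,I,\Sigma)$, a transition system with independence (states $S$, initial $s_0$, labels $\Sigma$, transitions $T\subseteq S\times\Sigma\times S$, irreflexive symmetric independence $I\subseteq T\times T$ satisfying the standard TSI axioms); finite means $S,T$ finite. For $t=(s,a,s')$: $\sigma(t)=s,\tau(t)=s',\delta(t)=a$. $t\otimes t'$ iff $\sigma(t)=\sigma(t')\wedge tIt'$; $t\ominus t'$ iff $\tau(t)=\sigma(t')\wedge tIt'$; $t\le t'$ iff $\tau(t)=\sigma(t')\wedge\neg tIt'$. $\mathfrak X(s)$ = transitions with source $s$; conflict-free set = set with common source, pairwise $\otimes$; support sets = the $\mathfrak X(s)$ and non-empty conflict-free sets; $M\sqsubseteq R$ iff $M\subseteq R$ and no $t\in R\setminus M$ has $t\otimes t'$ for all $t'\in M$; $\mathcal X$ = all $\mathfrak X(s)$ and all support sets $M\sqsubseteq\mathfrak X(s)$; $\mathfrak A=T\cup\{t_\epsilon\}$ with fresh $t_\epsilon$, $\tau(t_\epsilon)=s_0$, $t_\epsilon\le t$ whenever $\sigma(t)=s_0$, never $t_\epsilon\ominus t$; processes $\mathfrak S=\mathcal X\times\mathfrak A$. TFL: formulas $\phi::=Z\mid\neg\phi\mid\phi\wedge\phi\mid\langle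 a\rangle_c\phi\mid\langle a\rangle_{nc}\phi\mid\langle\otimes\rangle\phi\mid\mu Z.\phi$ (free occurrences of $Z$ in $\mu Z.\phi$ under an even number of negations), with duals $\vee$, $[a]_c$, $[a]_{nc}$, $[\otimes]$, $\nu Z.\phi$. A valuation is $\mathcal V:\mathrm{Var}\to2^{\mathfrak S}$. Positive normal form: negation only on variables, no two binders bind the same variable. $Sub(\phi)$ is the set of subformulas. Model-checking game $\mathcal G(H_0,\phi)$ between Eve and Adam: configurations $H\vdash\psi$ with $H\in\mathfrak S$, $\psi\in Sub(\phi)$; start $H_0\vdash\phi$. Rules: $H\vdash\mu Z.\psi$ or $H\vdash\nu Z.\psi$ moves to $H\vdash Z$; $H\vdash Z$ with $Z$ bound by $\mu Z.\psi$ or $\nu Z.\psi$ moves to $H\vdash\psi$; at $H\vdash\psi_0\vee\psi_1$ Eve (at $\wedge$, Adam) chooses $H\vdash\psi_i$; at $(R,t)\vdash\langle a\rangle_c\psi$ Eve (at $[a]_c\psi$, Adam) chooses $r\in R$ with $\delta(r)=a$, $t\le r$, moving to $(\mathfrak X(\tau(r)),r)\vdash\psi$; same for $\langle a\rangle_{nc}$/$[a]_{nc}$ with $t\ominus r$; at $(R,t)\vdash\langle\otimes\rangle\psi$ Eve (at $[\otimes]\psi$, Adam) chooses $M\in\mathcal X$ with $M\sqsubseteq R$, moving to $(M,t)\vdash\psi$. Adam wins a play iff it ends at $H\vdash Z$ ($Z$ free) with $H\notin\mathcal V(Z)$, or at a diamond configuration with no available choice, or is infinite and the syntactically outermost variable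 occurring infinitely often is bound by a $\mu$; Eve wins dually (ends at $H\vdash Z$ with $H\in\mathcal V(Z)$, at a box configuration with no available choice, or infinite with outermost infinitely-often variable bound by a $\nu$). -}

module Defs where

open import Level using (0ℓ)
open import Data.Bool.Base using (Bool; true; false)
open import Data.Empty using (⊥)
open import Data.Fin.Base using (Fin)
open import Data.Fin.Properties using (inj⇒≟)
open import Data.Fin.Subset using (Subset; _∈_; _∉_; _⊆_; Nonempty)
open import Data.List.Base using (List; []; _∷_; _++_; applyDownFrom)
open import Data.List.Relation.Unary.Unique.Propositional using (Unique)
open import Data.Maybe.Base using (Maybe; just; nothing)
open import Data.Nat.Base using (ℕ)
open import Data.Nat.InfinitelyOften using (Inf)
open import Data.Parity.Base using (Parity; 0ℙ; _⁻¹)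
open import Data.Product using (Σ; ∃; ∃₂; ∃-syntax; _×_; _,_; proj₁; proj₂)
open import Data.Sum.Base using (_⊎_; inj₁)
open import Data.Unit using (⊤)
open import Data.Vec.Base using (tabulate)
open import Function.Bundles using (_↣_; _↔_; Injection; Inverse)
open import Function.Properties.Inverse using (↔⇒↣)
open import Relation.Binary.Core using (Rel)
open import Relation.Binary.Definitions
  using (Irreflexive; Symmetric; Decidable; DecidableEquality)
open import Relation.Binary.Construct.Closure.Equivalence using (EqClosure)
open import Relation.Binary.Construct.Closure.ReflexiveTransitive
  using (Star; ε; _◅_; _◅◅_)
open import Relation.Binary.PropositionalEquality using (_≡_; _≢_; refl)
open import Relation.Nullary using (¬_; does)

------------------------------------------------------------------------
-- Transition systems with independence

module _ {S Label : Set} (_I_ : Rel (S × Label × S) 0ℓ) where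

  data _≺_ : Rel (S × Label × S) 0ℓ where
    square : ∀ {s s₁ s₂ q a} b →
             (s , a , s₁) I (s , b , s₂) →
             (s , a , s₁) I (s₁ , b , q) →
             (s , b , s₂) I (s₂ , a , q) →
             (s , a , s₁) ≺ (s₂ , a , q)

  _∼_ : Rel (S × Label × S) 0ℓ
  _∼_ = EqClosure _≺_

  -- The axioms of Winskel and Nielsen.
  record IsTSI : Set where
    field
      irreflexive : Irreflexive _≡_ _I_
      symmetric   : Symmetric _I_
      A1 : ∀ {s a s₁ s₂} → (s , a , s₁) ∼ (s , a , s₂) → s₁ ≡ s₂
      A2 : ∀ {s a s₁ b s₂} → (s , a , s₁) I (s , b , s₂) →
           ∃[ q ] (s , a , s₁) I (s₁ , b , q) × (s , b , s₂) I (s₂ , a , q)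
      A3 : ∀ {s a s₁ b q} → (s , a , s₁) I (s₁ , b , q) →
           ∃[ s₂ ] (s , a , s₁) I (s , b , s₂) × (s , b , s₂) I (s₂ , a , q)
      A4 : ∀ {x y z} → (x ≺ y) ⊎ (y ≺ x) → y I z → x I z

-- The finite set T ⊆ S × Label × S is given by an enumeration without
-- repetitions, so that sets of transitions are Subset ∣T∣.  Independence
-- and equality of labels are decidable because the system is an input of
-- an algorithm.
record FiniteTSI : Set₁ where
  field
    S         : Set
    ∣S∣       : ℕ
    S-finite  : S ↔ Fin ∣S∣
    s₀        : S
    Label     : Set
    _≟-Label_ : DecidableEquality Label
    ∣T∣       : ℕ
    T         : Fin ∣T∣ ↣ (S × Label × S)
    _I_       : Rel (S × Label × S) 0ℓ
    _I?_      : Decidable _I_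
    I⊆T×T     : ∀ {x y} → x I y →
                (∃[ t ] Injection.to T t ≡ x) × (∃[ t ] Injection.to T t ≡ y)
    isTSI     : IsTSI _I_

  _≟-S_ : DecidableEquality S
  _≟-S_ = inj⇒≟ (↔⇒↣ S-finite)

------------------------------------------------------------------------
-- Processes

Var : Set
Var = ℕ

data Modality (Label : Set) : Set where
  c nc : Label → Modality Label
  ⨂    : Modality Label

module System (𝔗 : FiniteTSI) where
  open FiniteTSI 𝔗 public

  Transition : Set
  Transition = Fin ∣T∣

  triple : Transition → S × Label × S
  triple = Injection.to T

  σ τ : Transition → S
  σ t = proj₁ (triple t)
  τ t = proj₂ (proj₂ (triple t))

  δ : Transition → Label
  δ t = proj₁ (proj₂ (triple t))

  _⊗_ : Rel Transition 0ℓ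
  t ⊗ t′ = σ t ≡ σ t′ × triple t I triple t′

  𝔛 : S → Subset ∣T∣
  𝔛 s = tabulate (λ t → does (σ t ≟-S s))

  ConflictFree : Subset ∣T∣ → Set
  ConflictFree R =
    (∃[ s ] (∀ {t} → t ∈ R → σ t ≡ s)) ×
    (∀ {t t′} → t ∈ R → t′ ∈ R → t ≢ t′ → t ⊗ t′)

  Support : Subset ∣T∣ → Set
  Support R = (∃[ s ] R ≡ 𝔛 s) ⊎ (Nonempty R × ConflictFree R)

  _⊑_ : Rel (Subset ∣T∣) 0ℓ
  M ⊑ R = M ⊆ R × ¬ (∃[ t ] t ∈ R × t ∉ M × (∀ {t′} → t′ ∈ M → t ⊗ t′))

  𝒳 : Subset ∣T∣ → Set
  𝒳 R = (∃[ s ] R ≡ 𝔛 s) ⊎ (Support R × (∃[ s ] R ⊑ 𝔛 s))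

  -- The transition t_ϵ is nothing.
  𝔄 : Set
  𝔄 = Maybe Transition

  _≤_ : 𝔄 → Transition → Set
  just t  ≤ r = τ t ≡ σ r × ¬ (triple t I triple r)
  nothing ≤ r = s₀ ≡ σ r

  _⊖_ : 𝔄 → Transition → Set
  just t  ⊖ r = τ t ≡ σ r × triple t I triple r
  nothing ⊖ r = ⊥

  -- Membership in 𝒳 is irrelevant, so that a process is determined by the
  -- pair (R , t).
  record Process : Set where
    constructor process
    field
      set  : Subset ∣T∣
      last : 𝔄
      .set∈𝒳 : 𝒳 set
  open Process

  after : S → 𝔄 → Process
  after s t = process (𝔛 s) t (inj₁ (s , refl))

  initial : Process
  initial = after s₀ nothing

  data _⟶[_]_ : Process → Modality Label → Process → Set where
    causal     : ∀ {H a} r → r ∈ set H → δ r ≡ a → last H ≤ r →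
                 H ⟶[ c a ] after (τ r) (just r)
    concurrent : ∀ {H a} r → r ∈ set H → δ r ≡ a → last H ⊖ r →
                 H ⟶[ nc a ] after (τ r) (just r)
    support    : ∀ {H} M (M∈𝒳 : 𝒳 M) → M ⊑ set H →
                 H ⟶[ ⨂ ] process M (last H) M∈𝒳

  Valuation : Set
  Valuation = Var → Process → Bool

------------------------------------------------------------------------
-- Trace fixpoint logic

data Fixpoint : Set where
  μ ν : Fixpoint

infixr 7 _∧_
infixr 6 _∨_
infix 8 ~_ ⟨_⟩_ [_]_

-- The dual operators are primitive, since positive normal forms use them.
data Formula (Label : Set) : Set where
  var     : Var → Formula Label
  ~_      : Formula Label → Formula Label
  _∧_ _∨_ : Formula Label → Formula Label → Formula Label
  ⟨_⟩_    : Modality Label → Formula Label → Formula Label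
  [_]_    : Modality Label → Formula Label → Formula Label
  fix     : Fixpoint → Var → Formula Label → Formula Label

module _ {Label : Set} where

  -- Immediate subformulas.  By fix-var, a bound variable counts as a
  -- subformula of its fixpoint formula even if it does not occur in the
  -- body, so that the move from H ⊢ μZ.ψ to H ⊢ Z always stays in Sub(φ).
  data _▸_ : Rel (Formula Label) 0ℓ where
    ~▸       : ∀ {φ} → (~ φ) ▸ φ
    ∧▸ˡ      : ∀ {φ ψ} → (φ ∧ ψ) ▸ φ
    ∧▸ʳ      : ∀ {φ ψ} → (φ ∧ ψ) ▸ ψ
    ∨▸ˡ      : ∀ {φ ψ} → (φ ∨ ψ) ▸ φ
    ∨▸ʳ      : ∀ {φ ψ} → (φ ∨ ψ) ▸ ψ
    ⟨⟩▸      : ∀ {m φ} → (⟨ m ⟩ φ) ▸ φ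
    []▸      : ∀ {m φ} → ([ m ] φ) ▸ φ
    fix-var  : ∀ {κ Z φ} → fix κ Z φ ▸ var Z
    fix-body : ∀ {κ Z φ} → fix κ Z φ ▸ φ

  -- An element of Sub φ ψ is an occurrence of ψ in φ.  Working with
  -- occurrences fixes which occurrences of a variable are bound, even in
  -- formulas such as Z ∧ μZ.Z.
  Sub : Rel (Formula Label) 0ℓ
  Sub = Star _▸_

  data FreeUnder (Z : Var) : Parity → Formula Label → Set where
    var : FreeUnder Z 0ℙ (var Z)
    ~_  : ∀ {p φ} → FreeUnder Z p φ → FreeUnder Z (p ⁻¹) (~ φ)
    ∧ˡ  : ∀ {p φ ψ} → FreeUnder Z p φ → FreeUnder Z p (φ ∧ ψ)
    ∧ʳ  : ∀ {p φ ψ} → FreeUnder Z p ψ → FreeUnder Z p (φ ∧ ψ)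
    ∨ˡ  : ∀ {p φ ψ} → FreeUnder Z p φ → FreeUnder Z p (φ ∨ ψ)
    ∨ʳ  : ∀ {p φ ψ} → FreeUnder Z p ψ → FreeUnder Z p (φ ∨ ψ)
    ⟨⟩  : ∀ {p m φ} → FreeUnder Z p φ → FreeUnder Z p (⟨ m ⟩ φ)
    []  : ∀ {p m φ} → FreeUnder Z p φ → FreeUnder Z p ([ m ] φ)
    fix : ∀ {p κ Y φ} → Y ≢ Z → FreeUnder Z p φ → FreeUnder Z p (fix κ Y φ)

  WellFormed : Formula Label → Set
  WellFormed φ = ∀ {κ Z ψ p} → Sub φ (fix κ Z ψ) → FreeUnder Z p ψ → p ≡ 0ℙ

  binders : Formula Label → List Var
  binders (var Z)     = []
  binders (~ φ)       = binders φ
  binders (φ ∧ ψ)     = binders φ ++ binders ψ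
  binders (φ ∨ ψ)     = binders φ ++ binders ψ
  binders (⟨ m ⟩ φ)   = binders φ
  binders ([ m ] φ)   = binders φ
  binders (fix κ Z φ) = Z ∷ binders φ

  record PositiveNormalForm (φ : Formula Label) : Set where
    field
      negation-on-variables : ∀ {ψ} → Sub φ (~ ψ) → ∃[ Z ] ψ ≡ var Z
      distinct-binders      : Unique (binders φ)

------------------------------------------------------------------------
-- The model-checking game

data Player : Set where
  Eve Adam : Player

owner : ∀ {Label} → Formula Label → Maybe Player
owner (_ ∨ _)   = just Eve
owner (⟨ _ ⟩ _) = just Eve
owner (_ ∧ _)   = just Adam
owner ([ _ ] _) = just Adam
owner _         = nothing

fixpointOf : Player → Fixpoint
fixpointOf Eve  = ν
fixpointOf Adam = μ

module Game (𝔗 : FiniteTSI) (𝒱 : System.Valuation 𝔗)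
            (H₀ : System.Process 𝔗) (φ : Formula (FiniteTSI.Label 𝔗)) where
  open System 𝔗

  infix 4 _⊢_

  record Config : Set where
    constructor _⊢_
    field
      proc      : Process
      {formula} : Formula Label
      sub       : Sub φ formula
  open Config

  start : Config
  start = H₀ ⊢ ε

  _at_ : ∀ {ψ χ} → Sub φ ψ → ψ ▸ χ → Sub φ χ
  p at i = p ◅◅ (i ◅ ε)

  data Move : Rel Config 0ℓ where
    unfold : ∀ {H κ Z ψ} {p : Sub φ (fix κ Z ψ)} →
             Move (H ⊢ p) (H ⊢ p at fix-var)
    -- The occurrence of Z lies below a binder of Z at b; with distinct
    -- binders there is at most one such b, and none if Z is free.
    loop   : ∀ {H κ Z ψ} {p : Sub φ (var Z)}
             (b : Sub φ (fix κ Z ψ)) (q : Sub (fix κ Z ψ) (var Z)) →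
             p ≡ b ◅◅ q → Move (H ⊢ p) (H ⊢ b at fix-body)
    left∨  : ∀ {H ψ₀ ψ₁} {p : Sub φ (ψ₀ ∨ ψ₁)} → Move (H ⊢ p) (H ⊢ p at ∨▸ˡ)
    right∨ : ∀ {H ψ₀ ψ₁} {p : Sub φ (ψ₀ ∨ ψ₁)} → Move (H ⊢ p) (H ⊢ p at ∨▸ʳ)
    left∧  : ∀ {H ψ₀ ψ₁} {p : Sub φ (ψ₀ ∧ ψ₁)} → Move (H ⊢ p) (H ⊢ p at ∧▸ˡ)
    right∧ : ∀ {H ψ₀ ψ₁} {p : Sub φ (ψ₀ ∧ ψ₁)} → Move (H ⊢ p) (H ⊢ p at ∧▸ʳ)
    step⟨⟩ : ∀ {H H′ m ψ} {p : Sub φ (⟨ m ⟩ ψ)} → H ⟶[ m ] H′ →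
             Move (H ⊢ p) (H′ ⊢ p at ⟨⟩▸)
    step[] : ∀ {H H′ m ψ} {p : Sub φ ([ m ] ψ)} → H ⟶[ m ] H′ →
             Move (H ⊢ p) (H′ ⊢ p at []▸)

  Terminal : Config → Set
  Terminal C = ∀ {C′} → ¬ Move C C′

  -- Winner of a finite play, by its last configuration.  Only applied to
  -- terminal configurations, where a variable is necessarily free; at H ⊢ ¬Z
  -- the winning condition is the dual of that at H ⊢ Z.
  WinsTerminal : Player → Config → Set
  WinsTerminal P C = go P (formula C)
    where
    go : Player → Formula Label → Set
    go Eve  (var Z)     = 𝒱 Z (proc C) ≡ true
    go Adam (var Z)     = 𝒱 Z (proc C) ≡ false
    go Eve  (~ (var Z)) = 𝒱 Z (proc C) ≡ false
    go Adam (~ (var Z)) = 𝒱 Z (proc C) ≡ true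
    go Adam (⟨ _ ⟩ _)   = ⊤
    go Eve  ([ _ ] _)   = ⊤
    go _    _           = ⊥

  Occurs : (ℕ → Config) → Var → ℕ → Set
  Occurs π Z n = formula (π n) ≡ var Z

  BoundBy : Fixpoint → Var → Set
  BoundBy κ Z = ∃[ ψ ] Sub φ (fix κ Z ψ)

  -- The binder of Y is, or lies inside, the binder of Z.
  Encloses : Var → Var → Set
  Encloses Z Y = ∃₂ λ κ ψ → ∃₂ λ κ′ ψ′ →
    Sub φ (fix κ Z ψ) × Sub (fix κ Z ψ) (fix κ′ Y ψ′)

  Outermost : (ℕ → Config) → Var → Set
  Outermost π Z = Inf (Occurs π Z) × (∀ Y → Inf (Occurs π Y) → Encloses Z Y)

  -- Classically every infinite play has exactly one outermost variable
  -- occurring infinitely often.  Constructively it cannot be computed from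
  -- the play, hence the universal quantifier.
  WinsInfinite : Player → (ℕ → Config) → Set
  WinsInfinite P π = ∀ Z → Outermost π Z → BoundBy (fixpointOf P) Z

  -- A strategy sees the earlier configurations, most recent first, and the
  -- current one.
  record Strategy (P : Player) : Set where
    field
      choose : List Config → Config → Config
      legal  : ∀ h C → owner (formula C) ≡ just P → ∃ (Move C) →
               Move C (choose h C)
  open Strategy

  data PlayFollowing {P : Player} (s : Strategy P) : List Config → Config → Set where
    begin  : PlayFollowing s [] start
    extend : ∀ {h C C′} → PlayFollowing s h C → Move C C′ →
             (owner (formula C) ≡ just P → C′ ≡ choose s h C) →
             PlayFollowing s (C ∷ h) C′

  record Winning {P : Player} (s : Strategy P) : Set where
    field
      finite   : ∀ {h C} → PlayFollowing s h C → Terminal C → WinsTerminal P C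
      infinite : ∀ (π : ℕ → Config) →
                 (∀ n → PlayFollowing s (applyDownFrom π n) (π n)) →
                 WinsInfinite P π

  HasWinningStrategy : Player → Set
  HasWinningStrategy P = Σ (Strategy P) Winning

{-# OPTIONS --safe #-}
module Submission where

-- The parity game is replaced by a finite one.  Along a play one remembers,
-- for every bound variable, the processes at which it has been visited since
-- the last visit to a variable with an earlier binder; the finite game stops
-- at the first repetition, which is won by the player owning the fixpoint.
-- Since these memories grow lexicographically, the finite game is determined
-- and solvable.  Its winner wins the infinite game by resuming, after a
-- repetition, with the memory of the first visit: if the outermost variable
-- visited infinitely often belonged to the opponent, its list of processes
-- would eventually only grow.  The two players cannot both win: the joint play
-- of two winning strategies is infinite, and its outermost variable, which
-- cannot fail to exist, would be bound by both μ and ν.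

open import Defs
open import Data.Bool.Base using (true; false)
import Data.Bool.Properties as Bool
open import Data.Empty using (⊥; ⊥-elim)
import Data.Fin.Properties as Fin
open import Data.Fin.Subset using (Subset; inside; outside) renaming (_∈_ to _∈ˢ_)
open import Data.Fin.Subset.Properties
  using (anySubset?; nonempty?)
  renaming (_∈?_ to _∈ˢ?_; _⊆?_ to _⊆ˢ?_)
open import Data.List.Base
  using (List; []; _∷_; _++_; filter; length; map; concatMap; allFin; applyDownFrom)
import Data.List.Membership.DecPropositional as DecMembership
open import Data.List.Membership.Propositional using (_∈_; _∉_; lose)
open import Data.List.Membership.Propositional.Properties
  using (∈-filter⁺; ∈-++⁺ˡ; ∈-++⁺ʳ; ∈-++⁻; ∈-map⁺; ∈-concat⁺′; ∈-allFin)
open import Data.List.Properties using (filter-notAll; ++-assoc; ++-identityʳ)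
open import Data.List.Relation.Unary.All using (All; []; _∷_)
import Data.List.Relation.Unary.All.Properties as All
open import Data.List.Relation.Unary.AllPairs using ([]; _∷_)
open import Data.List.Relation.Unary.Any using (here; there)
open import Data.List.Relation.Unary.Unique.Propositional using (Unique)
open import Data.List.Relation.Unary.Unique.Propositional.Properties using (Unique[x∷xs]⇒x∉xs)
open import Data.Maybe.Base using (just; nothing)
import Data.Maybe.Properties as Maybe
open import Data.Nat.Base as ℕ using (ℕ; zero; suc; s≤s; z≤n; _<_; _+_)
open import Data.Nat.Induction using (<-wellFounded)
open import Data.Nat.InfinitelyOften using (Inf)
open import Data.Nat.Properties as ℕ using (_≟_)
open import Data.Product using (∃; ∃₂; _×_; _,_; proj₁; proj₂; Σ; ∃!)
open import Data.Product.Relation.Binary.Lex.Strict using (×-Lex; ×-wellFounded)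
open import Data.Sum.Base using (_⊎_; inj₁; inj₂; [_,_]′; swap)
open import Data.Unit.Base using (⊤; tt)
open import Data.Vec.Base using ([]; _∷_)
import Data.Vec.Properties as Vec
open import Function.Base using (_∘_; id; case_of_)
open import Function.Bundles using (Inverse)
open import Induction.WellFounded using (WellFounded; Acc; acc)
open import Level using (0ℓ)
open import Relation.Binary.Construct.Closure.ReflexiveTransitive using (ε; _◅_; _◅◅_)
open import Relation.Binary.Construct.Closure.ReflexiveTransitive.Properties using (◅◅-assoc)
open import Relation.Binary.Core using (Rel)
open import Relation.Binary.Definitions using (DecidableEquality; Decidable)
open import Relation.Binary.PropositionalEquality
  using (_≡_; _≢_; refl; sym; trans; cong; subst)
open import Relation.Nullary
  using (¬_; Dec; yes; no; contradiction; ¬?; recompute; _×-dec_; _→-dec_; _⊎-dec_)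
open import Relation.Nullary.Decidable using (map′)
open import Relation.Unary using () renaming (Decidable to Decidable₁)

-- Memories of visited processes and their well-founded order

before : Var → List Var → List Var
before Z [] = []
before Z (Y ∷ Ys) with Y ≟ Z
... | yes _ = []
... | no _ = Y ∷ before Z Ys

module Memory {K : Set} (_≟ᴷ_ : DecidableEquality K)
              (universe : List K) (complete : ∀ k → k ∈ universe) where

  open DecMembership _≟ᴷ_ using (_∈?_)

  -- Cuts back to the oldest occurrence of k, which makes push-push hold for
  -- lists with repetitions too.
  popTo : K → List K → List K
  popTo k [] = []
  popTo k (x ∷ xs) with k ∈? xs
  ... | yes _ = popTo k xs
  ... | no _ = x ∷ xs

  push : K → List K → List K
  push k xs with k ∈? xs
  ... | yes _ = popTo k xs
  ... | no _ = k ∷ xs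

  push-∉ : ∀ {k xs} → k ∉ xs → push k xs ≡ k ∷ xs
  push-∉ {k} {xs} k∉ with k ∈? xs
  ... | yes k∈ = contradiction k∈ k∉
  ... | no _ = refl

  push-∈ : ∀ {k xs} → k ∈ xs → push k xs ≡ popTo k xs
  push-∈ {k} {xs} k∈ with k ∈? xs
  ... | yes _ = refl
  ... | no k∉ = contradiction k∈ k∉

  popTo-⊆ : ∀ {k j} xs → j ∈ popTo k xs → j ∈ xs
  popTo-⊆ {k} (x ∷ xs) j∈ with k ∈? xs
  ... | yes _ = there (popTo-⊆ xs j∈)
  ... | no _ = j∈

  popTo-∷ : ∀ {k x xs} → k ∈ xs → popTo k (x ∷ xs) ≡ popTo k xs
  popTo-∷ {k} {x} {xs} k∈ with k ∈? xs
  ... | yes _ = refl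
  ... | no k∉ = contradiction k∈ k∉

  push-popTo : ∀ {k j} xs → j ∈ popTo k xs → push j (popTo k xs) ≡ push j xs
  push-popTo {k} {j} (x ∷ xs) j∈ with k ∈? xs
  ... | no _ = refl
  ... | yes _ = trans (push-popTo xs j∈)
    (trans (push-∈ j∈xs) (sym (trans (push-∈ (there j∈xs)) (popTo-∷ j∈xs))))
    where j∈xs = popTo-⊆ xs j∈

  popTo-head : ∀ {k xs} → k ∉ xs → popTo k (k ∷ xs) ≡ k ∷ xs
  popTo-head {k} {xs} k∉ with k ∈? xs
  ... | yes k∈ = contradiction k∈ k∉
  ... | no _ = refl

  -- A repeated visit to `j` cuts the list back to its first visit, so whatever was pushed in
  -- between is forgotten: the memory at a repetition is again that of the first visit.
  push-push : ∀ {k j} xs → j ∈ push k xs →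
              push j (push k xs) ≡ push j xs × (j ≡ k ⊎ j ∈ xs)
  push-push {k} {j} xs j∈ with k ∈? xs
  ... | yes _ = push-popTo xs j∈ , inj₂ (popTo-⊆ xs j∈)
  push-push {k} {j} xs (here refl) | no k∉ =
    trans (push-∈ (here refl)) (trans (popTo-head k∉) (sym (push-∉ k∉))) , inj₁ refl
  push-push {k} {j} xs (there j∈) | no k∉ =
    trans (push-∈ (there j∈)) (trans (popTo-∷ j∈) (sym (push-∈ j∈))) , inj₂ j∈

  remaining : List K → List K
  remaining [] = universe
  remaining (k ∷ ks) = filter (λ j → ¬? (j ≟ᴷ k)) (remaining ks)

  ∈-remaining : ∀ {k} ks → k ∉ ks → k ∈ remaining ks
  ∈-remaining {k} [] k∉ = complete k
  ∈-remaining (j ∷ ks) k∉ =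
    ∈-filter⁺ (λ i → ¬? (i ≟ᴷ j)) (∈-remaining ks (k∉ ∘ there)) (k∉ ∘ here)

  room : List K → ℕ
  room = length ∘ remaining

  -- `k` is still among the remaining elements, and the new filter removes it.
  room-∷ : ∀ {k ks} → k ∉ ks → room (k ∷ ks) < room ks
  room-∷ {k} {ks} k∉ = filter-notAll (λ j → ¬? (j ≟ᴷ k)) (remaining ks)
    (lose (∈-remaining ks k∉) (λ k≢k → k≢k refl))

  Mem : List Var → Set
  Mem = All (λ _ → List K)

  empty : ∀ {Zs} → Mem Zs
  empty {[]} = []
  empty {_ ∷ _} = [] ∷ empty

  visited : ∀ {Zs} → Var → Mem Zs → List K
  visited Z [] = []
  visited Z (_∷_ {Y} ks m) with Y ≟ Z
  ... | yes _ = ks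
  ... | no _ = visited Z m

  -- Clearing the entries after `Z` makes them count only the visits since this one. The
  -- lexicographic order `_⊏_` tolerates the regained room, because a fresh visit takes room from
  -- the entry of `Z`, which comes first.
  visit : ∀ {Zs} → Var → K → Mem Zs → Mem Zs
  visit Z k [] = []
  visit Z k (_∷_ {Y} ks m) with Y ≟ Z
  ... | yes _ = push k ks ∷ empty
  ... | no _ = ks ∷ visit Z k m

  visited-empty : ∀ {Z} Zs → visited Z (empty {Zs}) ≡ []
  visited-empty [] = refl
  visited-empty {Z} (Y ∷ Zs) with Y ≟ Z
  ... | yes _ = refl
  ... | no _ = visited-empty Zs

  visited⇒∈ : ∀ {Zs Z k} (m : Mem Zs) → k ∈ visited Z m → Z ∈ Zs
  visited⇒∈ {Z = Z} (_∷_ {Y} ks m) k∈ with Y ≟ Z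
  ... | yes refl = here refl
  ... | no _ = there (visited⇒∈ m k∈)

  visited-visit : ∀ {Zs Z k} (m : Mem Zs) → Z ∈ Zs →
                  visited Z (visit Z k m) ≡ push k (visited Z m)
  visited-visit {Y ∷ Zs} {Z} (ks ∷ m) Z∈ with Y ≟ Z in eq
  visited-visit {Y ∷ Zs} {Z} (ks ∷ m) Z∈ | yes _ rewrite eq = refl
  visited-visit {Y ∷ Zs} {Z} (ks ∷ m) (here refl) | no Y≢Y = contradiction refl Y≢Y
  visited-visit {Y ∷ Zs} {Z} (ks ∷ m) (there Z∈) | no _ rewrite eq = visited-visit m Z∈

  visited-visit-other : ∀ {Zs Y Z k} (m : Mem Zs) → Y ∉ before Z Zs → Y ≢ Z →
                        visited Z (visit Y k m) ≡ visited Z m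
  visited-visit-other [] Y∉ Y≢Z = refl
  visited-visit-other {X ∷ Zs} {Y} {Z} (ks ∷ m) Y∉ Y≢Z with X ≟ Y | X ≟ Z in eq
  ... | yes refl | yes refl = contradiction refl Y≢Z
  ... | yes refl | no _ = contradiction (here refl) Y∉
  ... | no _ | yes _ rewrite eq = refl
  ... | no _ | no _ rewrite eq = visited-visit-other m (Y∉ ∘ there) Y≢Z

  -- If `Y` comes before `Z`, its entry is untouched and the new visit clears that of `Z`. If it
  -- comes after, its entry has just been cleared and cannot hold `j`. If they are equal,
  -- `push-push` applies.
  visit-visit : ∀ {Zs Y Z k j} (m : Mem Zs) → j ∈ visited Y (visit Z k m) →
                visit Y j (visit Z k m) ≡ visit Y j m ×
                ((Y ≡ Z × j ≡ k) ⊎ j ∈ visited Y m)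
  visit-visit {X ∷ Zs} {Y} {Z} (ks ∷ m) j∈ with X ≟ Z
  visit-visit {X ∷ Zs} {Y} {Z} (ks ∷ m) j∈ | yes X≡Z with X ≟ Y
  ... | yes X≡Y with eq , j∈′ ← push-push ks j∈ =
    cong (_∷ empty) eq ,
    [ (λ j≡k → inj₁ (trans (sym X≡Y) X≡Z , j≡k)) , inj₂ ]′ j∈′
  ... | no _ rewrite visited-empty {Y} Zs = contradiction j∈ λ ()
  visit-visit {X ∷ Zs} {Y} {Z} (ks ∷ m) j∈ | no _ with X ≟ Y
  ... | yes _ = refl , inj₂ j∈
  ... | no _ with eq , d ← visit-visit m j∈ = cong (ks ∷_) eq , d

  data _⊏_ : ∀ {Zs} → Rel (Mem Zs) 0ℓ where
    now   : ∀ {Z Zs xs ys} {m n : Mem Zs} → room xs < room ys →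
            _⊏_ {Z ∷ Zs} (xs ∷ m) (ys ∷ n)
    later : ∀ {Z Zs xs} {m n : Mem Zs} → m ⊏ n → _⊏_ {Z ∷ Zs} (xs ∷ m) (xs ∷ n)

  -- Nested induction: a `now` step installs an arbitrary tail, whose accessibility is taken afresh
  -- from `wf`.
  ⊏-acc : ∀ {Z Zs ks m} → WellFounded (_⊏_ {Zs}) → Acc _<_ (room ks) → Acc _⊏_ m →
          Acc (_⊏_ {Z ∷ Zs}) (ks ∷ m)
  ⊏-acc {Z} {Zs} wf = go
    where
    go : ∀ {ks m} → Acc _<_ (room ks) → Acc _⊏_ m → Acc (_⊏_ {Z ∷ Zs}) (ks ∷ m)
    later-acc : ∀ {ks m n} → Acc _<_ (room ks) → Acc _⊏_ m → n ⊏ (ks ∷ m) →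
                Acc (_⊏_ {Z ∷ Zs}) n
    go a b = acc (later-acc a b)
    later-acc (acc rs) b (now lt) = go (rs lt) (wf _)
    later-acc a (acc rs) (later lt) = go a (rs lt)

  ⊏-wellFounded : ∀ {Zs} → WellFounded (_⊏_ {Zs})
  ⊏-wellFounded {[]} [] = acc λ ()
  ⊏-wellFounded {Z ∷ Zs} (ks ∷ m) =
    ⊏-acc ⊏-wellFounded (<-wellFounded (room ks)) (⊏-wellFounded m)

  visit-⊏ : ∀ {Zs Z k} (m : Mem Zs) → Z ∈ Zs → k ∉ visited Z m → visit Z k m ⊏ m
  visit-⊏ {Y ∷ Zs} {Z} {k} (ks ∷ m) Z∈ k∉ with Y ≟ Z
  visit-⊏ {Y ∷ Zs} {Z} {k} (ks ∷ m) Z∈ k∉ | yes _ rewrite push-∉ k∉ = now (room-∷ k∉)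
  visit-⊏ (ks ∷ m) (here refl) k∉ | no Y≢Y = contradiction refl Y≢Y
  visit-⊏ (ks ∷ m) (there Z∈) k∉ | no _ = later (visit-⊏ m Z∈ k∉)

-- Binders, their preorder, and occurrences in the syntax tree

Unique-++⁻ˡ : ∀ {xs ys : List Var} → Unique (xs ++ ys) → Unique xs
Unique-++⁻ˡ {[]} u = []
Unique-++⁻ˡ {x ∷ xs} (p ∷ u) = All.++⁻ˡ xs p ∷ Unique-++⁻ˡ u

Unique-++⁻ʳ : ∀ (xs : List Var) {ys} → Unique (xs ++ ys) → Unique ys
Unique-++⁻ʳ [] u = u
Unique-++⁻ʳ (x ∷ xs) (_ ∷ u) = Unique-++⁻ʳ xs u

Unique-disjoint : ∀ {xs ys : List Var} {z} → Unique (xs ++ ys) → z ∈ xs → z ∉ ys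
Unique-disjoint {x ∷ xs} u (here refl) z∈ys =
  Unique[x∷xs]⇒x∉xs u (∈-++⁺ʳ xs z∈ys)
Unique-disjoint (_ ∷ u) (there z∈xs) z∈ys = Unique-disjoint u z∈xs z∈ys

before-++ʳ : ∀ {Z} Xs {Ys} → Z ∉ Xs → before Z (Xs ++ Ys) ≡ Xs ++ before Z Ys
before-++ʳ [] Z∉ = refl
before-++ʳ {Z} (X ∷ Xs) Z∉ with X ≟ Z
... | yes refl = contradiction (here refl) Z∉
... | no _ = cong (X ∷_) (before-++ʳ Xs (Z∉ ∘ there))

before-head : ∀ {Z} Xs → before Z (Z ∷ Xs) ≡ []
before-head {Z} Xs with Z ≟ Z
... | yes _ = refl
... | no Z≢Z = contradiction refl Z≢Z

Infix : List Var → List Var → Set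
Infix xs ys = ∃₂ λ ls rs → ys ≡ ls ++ xs ++ rs

infix-++ʳ : ∀ {xs ys zs} → Infix xs ys → Infix xs (ys ++ zs)
infix-++ʳ {xs} {zs = zs} (ls , rs , refl) = ls , rs ++ zs ,
  trans (++-assoc ls (xs ++ rs) zs) (cong (ls ++_) (++-assoc xs rs zs))

infix-++ˡ : ∀ {xs ys zs} → Infix xs ys → Infix xs (zs ++ ys)
infix-++ˡ {xs} {zs = zs} (ls , rs , refl) = zs ++ ls , rs , sym (++-assoc zs ls (xs ++ rs))

before-∷ : ∀ {X Y Z} Xs → Y ∈ before Z (X ∷ Xs) → Y ≡ X ⊎ Y ∈ before Z Xs
before-∷ {X} {Z = Z} Xs Y∈ with X ≟ Z
before-∷ Xs (here Y≡X) | no _ = inj₁ Y≡X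
before-∷ Xs (there Y∈) | no _ = inj₂ Y∈

module _ {Label : Set} where

  private
    F = Formula Label

  -- Variables have size zero, so that even the move from a fixpoint formula to its variable
  -- decreases the size.
  size : F → ℕ
  size (var _) = 0
  size (~ φ) = suc (size φ)
  size (φ ∧ ψ) = suc (size φ + size ψ)
  size (φ ∨ ψ) = suc (size φ + size ψ)
  size (⟨ _ ⟩ φ) = suc (size φ)
  size ([ _ ] φ) = suc (size φ)
  size (fix _ _ φ) = suc (size φ)

  -- The order of the list binders is the preorder of the syntax tree.
  binders-infix : ∀ {φ χ : F} → Sub φ χ → Infix (binders χ) (binders φ)
  binders-infix {φ} ε = [] , [] , sym (++-identityʳ (binders φ))
  binders-infix (~▸ ◅ p) = binders-infix p
  binders-infix (∧▸ˡ ◅ p) = infix-++ʳ (binders-infix p)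
  binders-infix (∧▸ʳ ◅ p) = infix-++ˡ (binders-infix p)
  binders-infix (∨▸ˡ ◅ p) = infix-++ʳ (binders-infix p)
  binders-infix (∨▸ʳ ◅ p) = infix-++ˡ (binders-infix p)
  binders-infix (⟨⟩▸ ◅ p) = binders-infix p
  binders-infix ([]▸ ◅ p) = binders-infix p
  binders-infix (fix-var ◅ ε) = [] , _ , refl
  binders-infix (fix-body {Z = Z} ◅ p) = infix-++ˡ {zs = Z ∷ []} (binders-infix p)

  Binder : F → Var → Set
  Binder φ Z = ∃₂ λ κ ψ → Sub φ (fix κ Z ψ)

  binder⇒∈ : ∀ {φ Z} → Binder φ Z → Z ∈ binders φ
  binder⇒∈ (κ , ψ , b) with xs , ys , eq ← binders-infix b =
    subst (_ ∈_) (sym eq) (∈-++⁺ʳ xs (here refl))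

  step-binder : ∀ {φ ψ Z} → φ ▸ ψ → Binder ψ Z → Binder φ Z
  step-binder i (κ , χ , b) = κ , χ , i ◅ b

  ∈⇒binder : ∀ φ {Z} → Z ∈ binders φ → Binder φ Z
  ∈⇒binder (~ φ) Z∈ = step-binder ~▸ (∈⇒binder φ Z∈)
  ∈⇒binder (φ ∧ ψ) Z∈ with ∈-++⁻ (binders φ) Z∈
  ... | inj₁ Z∈ˡ = step-binder ∧▸ˡ (∈⇒binder φ Z∈ˡ)
  ... | inj₂ Z∈ʳ = step-binder ∧▸ʳ (∈⇒binder ψ Z∈ʳ)
  ∈⇒binder (φ ∨ ψ) Z∈ with ∈-++⁻ (binders φ) Z∈
  ... | inj₁ Z∈ˡ = step-binder ∨▸ˡ (∈⇒binder φ Z∈ˡ)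
  ... | inj₂ Z∈ʳ = step-binder ∨▸ʳ (∈⇒binder ψ Z∈ʳ)
  ∈⇒binder (⟨ _ ⟩ φ) Z∈ = step-binder ⟨⟩▸ (∈⇒binder φ Z∈)
  ∈⇒binder ([ _ ] φ) Z∈ = step-binder []▸ (∈⇒binder φ Z∈)
  ∈⇒binder (fix κ Y φ) (here refl) = κ , φ , ε
  ∈⇒binder (fix κ Y φ) (there Z∈) = step-binder fix-body (∈⇒binder φ Z∈)

  -- Two paths that branch would put `Z` into both halves of the list of binders; a path extending
  -- the other would put `Z` below its own binder. Either way `Z` would be listed twice.
  binder-unique : ∀ {φ Z} → Unique (binders φ) → (b b′ : Binder φ Z) → b ≡ b′
  binder-unique u (_ , _ , ε) (_ , _ , ε) = refl
  binder-unique u (_ , _ , ε) (_ , _ , (fix-body ◅ b)) =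
    contradiction (binder⇒∈ (_ , _ , b)) (Unique[x∷xs]⇒x∉xs u)
  binder-unique u (_ , _ , (fix-body ◅ b)) (_ , _ , ε) =
    contradiction (binder⇒∈ (_ , _ , b)) (Unique[x∷xs]⇒x∉xs u)
  binder-unique u (_ , _ , (fix-var ◅ (() ◅ _))) _
  binder-unique u _ (_ , _ , (fix-var ◅ (() ◅ _)))
  binder-unique u (_ , _ , (∧▸ˡ ◅ b)) (_ , _ , (∧▸ʳ ◅ b′)) =
    contradiction (binder⇒∈ (_ , _ , b′)) (Unique-disjoint u (binder⇒∈ (_ , _ , b)))
  binder-unique u (_ , _ , (∧▸ʳ ◅ b)) (_ , _ , (∧▸ˡ ◅ b′)) =
    contradiction (binder⇒∈ (_ , _ , b)) (Unique-disjoint u (binder⇒∈ (_ , _ , b′)))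
  binder-unique u (_ , _ , (∨▸ˡ ◅ b)) (_ , _ , (∨▸ʳ ◅ b′)) =
    contradiction (binder⇒∈ (_ , _ , b′)) (Unique-disjoint u (binder⇒∈ (_ , _ , b)))
  binder-unique u (_ , _ , (∨▸ʳ ◅ b)) (_ , _ , (∨▸ˡ ◅ b′)) =
    contradiction (binder⇒∈ (_ , _ , b)) (Unique-disjoint u (binder⇒∈ (_ , _ , b′)))
  binder-unique u (_ , _ , (~▸ ◅ b)) (_ , _ , (~▸ ◅ b′)) =
    cong (step-binder ~▸) (binder-unique u (_ , _ , b) (_ , _ , b′))
  binder-unique u (_ , _ , (∧▸ˡ ◅ b)) (_ , _ , (∧▸ˡ ◅ b′)) =
    cong (step-binder ∧▸ˡ) (binder-unique (Unique-++⁻ˡ u) (_ , _ , b) (_ , _ , b′))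
  binder-unique u (_ , _ , (∧▸ʳ {φ = φ} ◅ b)) (_ , _ , (∧▸ʳ ◅ b′)) =
    cong (step-binder ∧▸ʳ) (binder-unique (Unique-++⁻ʳ (binders φ) u) (_ , _ , b) (_ , _ , b′))
  binder-unique u (_ , _ , (∨▸ˡ ◅ b)) (_ , _ , (∨▸ˡ ◅ b′)) =
    cong (step-binder ∨▸ˡ) (binder-unique (Unique-++⁻ˡ u) (_ , _ , b) (_ , _ , b′))
  binder-unique u (_ , _ , (∨▸ʳ {φ = φ} ◅ b)) (_ , _ , (∨▸ʳ ◅ b′)) =
    cong (step-binder ∨▸ʳ) (binder-unique (Unique-++⁻ʳ (binders φ) u) (_ , _ , b) (_ , _ , b′))
  binder-unique u (_ , _ , (⟨⟩▸ ◅ b)) (_ , _ , (⟨⟩▸ ◅ b′)) =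
    cong (step-binder ⟨⟩▸) (binder-unique u (_ , _ , b) (_ , _ , b′))
  binder-unique u (_ , _ , ([]▸ ◅ b)) (_ , _ , ([]▸ ◅ b′)) =
    cong (step-binder []▸) (binder-unique u (_ , _ , b) (_ , _ , b′))
  binder-unique (_ ∷ u) (_ , _ , (fix-body ◅ b)) (_ , _ , (fix-body ◅ b′)) =
    cong (step-binder fix-body) (binder-unique u (_ , _ , b) (_ , _ , b′))

  -- The preorder lists the binders inside that of `Z` from `Z` onwards, and no variable is listed a
  -- second time ahead of it.
  enclosed⇒∉before : ∀ {φ ψ : F} {κ Z Y} → Unique (binders φ) → Sub φ (fix κ Z ψ) →
                     Y ∈ Z ∷ binders ψ → Y ∉ before Z (binders φ)
  enclosed⇒∉before {φ} {ψ} {κ} {Z} {Y} u b Y∈ Y∈before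
    with xs , ys , eq ← binders-infix b rewrite eq =
    Unique-disjoint u Y∈xs (∈-++⁺ˡ Y∈)
    where
    Z∉xs : Z ∉ xs
    Z∉xs Z∈xs = Unique-disjoint u Z∈xs (here refl)
    Y∈xs : Y ∈ xs
    Y∈xs = subst (Y ∈_)
      (trans (before-++ʳ xs Z∉xs)
        (trans (cong (xs ++_) (before-head (binders ψ ++ ys))) (++-identityʳ xs))) Y∈before

  encloses⇒∈before : ∀ {φ ψ : F} {κ Z Y} → Unique (binders φ) → Sub φ (fix κ Y ψ) →
                     Z ∈ binders ψ → Y ∈ before Z (binders φ)
  encloses⇒∈before {φ} {ψ} {κ} {Z} {Y} u b Z∈ with xs , ys , eq ← binders-infix b
    rewrite eq = subst (Y ∈_) (sym before≡) (∈-++⁺ʳ xs (here refl))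
    where
    u′ : Unique ((Y ∷ []) ++ (binders ψ ++ ys))
    u′ = Unique-++⁻ʳ xs u
    Z∉xs : Z ∉ xs
    Z∉xs Z∈xs = Unique-disjoint u Z∈xs (there (∈-++⁺ˡ Z∈))
    Z∉Y : Z ∉ Y ∷ []
    Z∉Y Z∈Y = Unique-disjoint u′ Z∈Y (∈-++⁺ˡ Z∈)
    before≡ : before Z (xs ++ Y ∷ (binders ψ ++ ys)) ≡ xs ++ Y ∷ before Z (binders ψ ++ ys)
    before≡ = trans (before-++ʳ xs Z∉xs) (cong (xs ++_) (before-++ʳ (Y ∷ []) Z∉Y))

  -- Stated for arbitrary tails, where matching on `refl` succeeds, in order to be applied to
  -- composites `b ◅◅ q`, on which unification is stuck.
  ◅-injective : ∀ {φ ψ ψ′ χ : F} {i : φ ▸ ψ} {j : φ ▸ ψ′} {p : Sub ψ χ} {q : Sub ψ′ χ} →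
                _≡_ {A = Sub φ χ} (i ◅ p) (j ◅ q) →
                _≡_ {A = ∃ (φ ▸_)} (ψ , i) (ψ′ , j) ×
                (∃ λ (e : ψ ≡ ψ′) → subst (λ ψ → Sub ψ χ) e p ≡ q)
  ◅-injective refl = refl , refl , refl

  ◅◅-identityʳ : ∀ {φ ψ : F} (p : Sub φ ψ) → p ◅◅ ε ≡ p
  ◅◅-identityʳ ε = refl
  ◅◅-identityʳ (i ◅ p) = cong (i ◅_) (◅◅-identityʳ p)

  -- Prefixes of one path form a chain; hence binders above the same occurrence are nested.
  ◅◅-comparable : ∀ {φ ψ ψ′ χ : F} (b : Sub φ ψ) {q : Sub ψ χ} (b′ : Sub φ ψ′) {q′ : Sub ψ′ χ} →
                  b ◅◅ q ≡ b′ ◅◅ q′ →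
                  (∃ λ r → b′ ≡ b ◅◅ r) ⊎ (∃ λ r → b ≡ b′ ◅◅ r)
  ◅◅-comparable ε b′ eq = inj₁ (b′ , refl)
  ◅◅-comparable (i ◅ b) ε eq = inj₂ (i ◅ b , refl)
  ◅◅-comparable (i ◅ b) (j ◅ b′) eq
    with refl , refl , eq′ ← ◅-injective eq with ◅◅-comparable b b′ eq′
  ... | inj₁ (r , refl) = inj₁ (r , refl)
  ... | inj₂ (r , refl) = inj₂ (r , refl)

  LoopAt : ∀ {φ : F} {Z} → Sub φ (var Z) → Set
  LoopAt {φ} {Z} p = ∃₂ λ κ ψ → Σ (Sub φ (fix κ Z ψ)) λ b → ∃ λ q → p ≡ b ◅◅ q

  binds? : ∀ (φ : F) Z → Dec (∃₂ λ κ ψ → φ ≡ fix κ Z ψ)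
  binds? (fix κ Y ψ) Z with Y ≟ Z
  ... | yes refl = yes (κ , ψ , refl)
  ... | no Y≢Z = no λ { (_ , _ , refl) → Y≢Z refl }
  binds? (var _) Z = no λ ()
  binds? (~ _) Z = no λ ()
  binds? (_ ∧ _) Z = no λ ()
  binds? (_ ∨ _) Z = no λ ()
  binds? (⟨ _ ⟩ _) Z = no λ ()
  binds? ([ _ ] _) Z = no λ ()

  loopAt? : ∀ {φ : F} {Z} (p : Sub φ (var Z)) → Dec (LoopAt p)
  loopAt? ε = no λ { (_ , _ , (() ◅ _) , _) }
  loopAt? {φ} {Z} (i ◅ p) with binds? φ Z | loopAt? p
  ... | yes (κ , ψ , refl) | _ = yes (κ , ψ , ε , i ◅ p , refl)
  ... | no _ | yes (κ , ψ , b , q , refl) = yes (κ , ψ , i ◅ b , q , refl)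
  ... | no ¬binds | no ¬loop = no refute
    where
    refute : ¬ LoopAt (i ◅ p)
    refute (κ , ψ , ε , _ , _) = ¬binds (κ , ψ , refl)
    refute (κ , ψ , (_ ◅ b) , q , refl) = ¬loop (κ , ψ , b , q , refl)

-- Searching the finitely many successors

-- A disjunction rather than a decidable predicate, since determinacy of the
-- successors is known before it is known that only one player wins.
Searchable : {A : Set} → (A → Set) → Set₁
Searchable {A} R = {P Q : A → Set} → (∀ {x} → R x → P x ⊎ Q x) →
                   (∃ λ x → R x × P x) ⊎ (∀ {x} → R x → Q x)

-- `P` itself need not be decidable, but which side of a computed disjunction was returned is; the
-- exhaustive search is run on the latter.
IsInj₁ : {A B : Set} → A ⊎ B → Set
IsInj₁ (inj₁ _) = ⊤
IsInj₁ (inj₂ _) = ⊥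

search-image : {X A : Set} → (∀ {P : X → Set} → Decidable₁ P → Dec (∃ P)) →
               {R : X → Set} → Decidable₁ R → {S : A → Set} (g : ∀ x → .(R x) → A) →
               (∀ x (r : R x) → S (g x r)) →
               (∀ {y} → S y → ∃ λ x → Σ (R x) λ r → y ≡ g x r) → Searchable S
search-image any {R} R? {S} g sound complete {P} {Q} f = conclude (any (fromInj₁? ∘ try))
  where
  Success Failure : _ → Set
  Success x = Σ (R x) λ r → P (g x r)
  Failure x = (r : R x) → Q (g x r)
  try : ∀ x → Success x ⊎ Failure x
  try x with R? x
  ... | no ¬r = inj₂ λ r → contradiction r ¬r
  ... | yes r with f (sound x r)
  ... | inj₁ p = inj₁ (r , p)
  -- `g` takes the guard as an irrelevant argument, so failure for the guard found is failure for
  -- every guard.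
  ... | inj₂ q = inj₂ λ _ → q
  fromInj₁? : ∀ {A B : Set} (s : A ⊎ B) → Dec (IsInj₁ s)
  fromInj₁? (inj₁ _) = yes _
  fromInj₁? (inj₂ _) = no id
  conclude : Dec (∃ (IsInj₁ ∘ try)) → (∃ λ y → S y × P y) ⊎ (∀ {y} → S y → Q y)
  conclude (yes (x , is)) with inj₁ (r , p) ← try x = inj₁ (g x r , sound x r , p)
  conclude (no ∄) = inj₂ λ Sy → refute (complete Sy)
    where
    refute : ∀ {y} → (∃ λ x → Σ (R x) λ r → y ≡ g x r) → Q y
    refute (x , r , refl) with try x in eq
    ... | inj₁ _ = contradiction (x , subst IsInj₁ (sym eq) tt) ∄
    ... | inj₂ q = q r

-- Enumeration of processes and decidability of the transition relation

subsets : ∀ n → List (Subset n)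
subsets zero = [] ∷ []
subsets (suc n) = map (outside ∷_) (subsets n) ++ map (inside ∷_) (subsets n)

∈-subsets : ∀ {n} (R : Subset n) → R ∈ subsets n
∈-subsets [] = here refl
∈-subsets (false ∷ R) = ∈-++⁺ˡ (∈-map⁺ (outside ∷_) (∈-subsets R))
∈-subsets (true ∷ R) = ∈-++⁺ʳ (map (outside ∷_) (subsets _)) (∈-map⁺ (inside ∷_) (∈-subsets R))

module SystemProperties (𝔗 : FiniteTSI) where
  open System 𝔗
  open Process

  any-S? : {P : S → Set} → Decidable₁ P → Dec (∃ P)
  any-S? {P} P? = map′
    (λ (i , p) → Inverse.from S-finite i , p)
    (λ (s , p) → Inverse.to S-finite s ,
                 subst P (sym (Inverse.strictlyInverseʳ S-finite s)) p)
    (Fin.any? (P? ∘ Inverse.from S-finite))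

  _⊗?_ : Decidable _⊗_
  t ⊗? t′ = (σ t ≟-S σ t′) ×-dec (triple t I? triple t′)

  _≟ˢ_ : DecidableEquality (Subset ∣T∣)
  _≟ˢ_ = Vec.≡-dec Bool._≟_

  all-∈? : (R : Subset ∣T∣) {P : Transition → Set} → Decidable₁ P →
           Dec (∀ {t} → t ∈ˢ R → P t)
  all-∈? R P? = map′ (λ f {t} → f t) (λ f t → f {t}) (Fin.all? λ t → (t ∈ˢ? R) →-dec P? t)

  _⊑?_ : Decidable _⊑_
  M ⊑? R = (M ⊆ˢ? R) ×-dec ¬? (Fin.any? λ t →
    (t ∈ˢ? R) ×-dec (¬? (t ∈ˢ? M) ×-dec all-∈? M (t ⊗?_)))

  conflictFree? : Decidable₁ ConflictFree
  conflictFree? R =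
    any-S? (λ s → all-∈? R (λ t → σ t ≟-S s)) ×-dec
    map′ (λ f t∈ t′∈ → f t∈ t′∈) (λ f {t} t∈ {t′} t′∈ → f {t} {t′} t∈ t′∈)
      (all-∈? R (λ t → all-∈? R (λ t′ → ¬? (t Fin.≟ t′) →-dec (t ⊗? t′))))

  is-𝔛? : ∀ R → Dec (∃ λ s → R ≡ 𝔛 s)
  is-𝔛? R = any-S? (λ s → R ≟ˢ 𝔛 s)

  𝒳? : Decidable₁ 𝒳
  𝒳? R = is-𝔛? R ⊎-dec
    ((is-𝔛? R ⊎-dec (nonempty? R ×-dec conflictFree? R)) ×-dec any-S? (λ s → R ⊑? 𝔛 s))

  _≟ᴾ_ : DecidableEquality Process
  process R t _ ≟ᴾ process R′ t′ _ = map′ (λ { (refl , refl) → refl }) (λ { refl → refl , refl })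
    ((R ≟ˢ R′) ×-dec Maybe.≡-dec Fin._≟_ t t′)

  processesAt : 𝔄 → Subset ∣T∣ → List Process
  processesAt t R with 𝒳? R
  ... | yes R∈𝒳 = process R t R∈𝒳 ∷ []
  ... | no _ = []

  ∈-processesAt : ∀ H → H ∈ processesAt (last H) (set H)
  ∈-processesAt (process R t R∈𝒳) with 𝒳? R
  ... | yes _ = here refl
  -- The membership stored in a process is irrelevant; its decision procedure makes it usable again.
  ... | no R∉𝒳 = ⊥-elim (R∉𝒳 (recompute (no R∉𝒳) R∈𝒳))

  processes : List Process
  processes = concatMap (λ t → concatMap (processesAt t) (subsets ∣T∣))
                        (nothing ∷ map just (allFin ∣T∣))

  ∈-processes : ∀ H → H ∈ processes
  ∈-processes H = ∈-concat⁺′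
    (∈-concat⁺′ (∈-processesAt H) (∈-map⁺ (processesAt (last H)) (∈-subsets (set H))))
    (∈-map⁺ (λ t → concatMap (processesAt t) (subsets ∣T∣)) (∈-𝔄 (last H)))
    where
    ∈-𝔄 : (t : 𝔄) → t ∈ nothing ∷ map just (allFin ∣T∣)
    ∈-𝔄 nothing = here refl
    ∈-𝔄 (just t) = there (∈-map⁺ just (∈-allFin t))

  _≤?_ : Decidable _≤_
  just t ≤? r = (τ t ≟-S σ r) ×-dec ¬? (triple t I? triple r)
  nothing ≤? r = s₀ ≟-S σ r

  _⊖?_ : Decidable _⊖_
  just t ⊖? r = (τ t ≟-S σ r) ×-dec (triple t I? triple r)
  nothing ⊖? r = no id

  search-⟶ : ∀ H m → Searchable (H ⟶[ m ]_)
  search-⟶ H (c a) = search-image Fin.any?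
    (λ r → (r ∈ˢ? set H) ×-dec ((δ r ≟-Label a) ×-dec (last H ≤? r)))
    (λ r _ → after (τ r) (just r))
    (λ { r (r∈ , δr≡a , ≤r) → causal {H = H} r r∈ δr≡a ≤r })
    (λ { (causal r r∈ δr≡a ≤r) → r , (r∈ , δr≡a , ≤r) , refl })
  search-⟶ H (nc a) = search-image Fin.any?
    (λ r → (r ∈ˢ? set H) ×-dec ((δ r ≟-Label a) ×-dec (last H ⊖? r)))
    (λ r _ → after (τ r) (just r))
    (λ { r (r∈ , δr≡a , ⊖r) → concurrent {H = H} r r∈ δr≡a ⊖r })
    (λ { (concurrent r r∈ δr≡a ⊖r) → r , (r∈ , δr≡a , ⊖r) , refl })
  search-⟶ H ⨂ = search-image anySubset?
    (λ M → 𝒳? M ×-dec (M ⊑? set H))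
    (λ M M∈⊑ → process M (last H) (proj₁ M∈⊑))
    (λ { M (M∈𝒳 , M⊑) → support {H = H} M M∈𝒳 M⊑ })
    (λ { (support M M∈𝒳 M⊑) → M , (M∈𝒳 , M⊑) , refl })

search-one : {A : Set} {R : A → Set} {x : A} → R x → (∀ {y} → R y → y ≡ x) → Searchable R
search-one {x = x} Rx unique f with f Rx
... | inj₁ p = inj₁ (x , Rx , p)
... | inj₂ q = inj₂ λ Ry → subst _ (sym (unique Ry)) q

search-none : {A : Set} {R : A → Set} → (∀ {x} → ¬ R x) → Searchable R
search-none ∄ f = inj₂ λ Rx → contradiction Rx ∄

search-two : {A : Set} {R : A → Set} {x y : A} → R x → R y →
             (∀ {z} → R z → z ≡ x ⊎ z ≡ y) → Searchable R
search-two {x = x} {y} Rx Ry only {Q = Q} f with f Rx | f Ry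
... | inj₁ p | _ = inj₁ (x , Rx , p)
... | inj₂ _ | inj₁ p = inj₁ (y , Ry , p)
... | inj₂ q | inj₂ q′ = inj₂ λ Rz →
  [ (λ z≡x → subst Q (sym z≡x) q) , (λ z≡y → subst Q (sym z≡y) q′) ]′ (only Rz)

opponent : Player → Player
opponent Eve = Adam
opponent Adam = Eve

-- Infinite recurrence and descent

-- Inf is doubly negated, so finitely many instances of excluded middle are
-- available when a contradiction is to be derived.
first-infinite : ∀ (P : Var → ℕ → Set) Zs →
                 ¬ ¬ ((∃ λ Z → Z ∈ Zs × Inf (P Z) × ∀ {Y} → Y ∈ before Z Zs → ¬ Inf (P Y)) ⊎
                      (∀ {Z} → Z ∈ Zs → ¬ Inf (P Z)))
first-infinite P [] k = k (inj₂ λ ())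
first-infinite P (X ∷ Xs) k = ¬infinite λ infinite →
  k (inj₁ (X , here refl , infinite , λ Y∈ → contradiction (subst (_ ∈_) (before-head Xs) Y∈) λ ()))
  where
  ¬infinite : ¬ ¬ Inf (P X)
  ¬infinite ¬inf = first-infinite P Xs λ where
    (inj₂ none) → k (inj₂ λ { (here refl) → ¬inf ; (there Z∈) → none Z∈ })
    (inj₁ (Z , Z∈ , inf , earlier)) → k (inj₁ (Z , there Z∈ , inf , λ Y∈ →
      case before-∷ Xs Y∈ of λ { (inj₁ refl) → ¬inf ; (inj₂ Y∈Xs) → earlier Y∈Xs }))

-- `¬ Inf` is the double negation of having a last moment; under one double negation the finitely
-- many bounds are combined by their maximum.
eventually-never : ∀ (P : Var → ℕ → Set) Zs → (∀ {Z} → Z ∈ Zs → ¬ Inf (P Z)) →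
                   ¬ ¬ ∃ λ N → ∀ {Z} → Z ∈ Zs → ∀ n → N ℕ.≤ n → ¬ P Z n
eventually-never P [] finite k = k (0 , λ ())
eventually-never P (Z ∷ Zs) finite k =
  finite (here refl) λ (M , never) → eventually-never P Zs (finite ∘ there) λ (N , nevers) →
    k (M ℕ.⊔ N , λ where
      (here refl) n ≤n → never n (ℕ.≤-trans (ℕ.m≤m⊔n M N) ≤n)
      (there Z∈) n ≤n → nevers Z∈ n (ℕ.≤-trans (ℕ.m≤n⊔m M N) ≤n))

descent : ∀ {P : ℕ → Set} (f : ℕ → ℕ) N → (∀ n → N ℕ.≤ n → f (suc n) ℕ.≤ f n) →
          (∀ n → N ℕ.≤ n → P n → f (suc n) < f n) → ¬ Inf P
descent {P} f N weak strict inf = go N ℕ.≤-refl (<-wellFounded (f N))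
  where
  decreasing : ∀ {m n} → N ℕ.≤ m → m ℕ.≤′ n → f n ℕ.≤ f m
  decreasing N≤m ℕ.≤′-refl = ℕ.≤-refl
  decreasing N≤m (ℕ.≤′-step m≤n) =
    ℕ.≤-trans (weak _ (ℕ.≤-trans N≤m (ℕ.≤′⇒≤ m≤n))) (decreasing N≤m m≤n)
  go : ∀ n → N ℕ.≤ n → Acc _<_ (f n) → ⊥
  -- `n` is offered as a bound for `P`; a later `m` satisfying `P` brings `f` strictly below `f n`,
  -- where the induction continues.
  go n N≤n (acc rs) = inf (n , λ m n≤m Pm →
    let N≤m = ℕ.≤-trans N≤n n≤m in
    go (suc m) (ℕ.m≤n⇒m≤1+n N≤m)
      (rs (ℕ.<-≤-trans (strict m N≤m Pm) (decreasing N≤n (ℕ.≤⇒≤′ n≤m)))))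

-- The finite game and its determinacy

module GameProperties (𝔗 : FiniteTSI) (𝒱 : System.Valuation 𝔗) (H₀ : System.Process 𝔗)
  (φ : Formula (FiniteTSI.Label 𝔗))
  (distinct : Unique (binders φ)) (negated : ∀ {ψ} → Sub φ (~ ψ) → ∃ λ Z → ψ ≡ var Z)
  (_≟ᴾ_ : DecidableEquality (System.Process 𝔗))
  (processes : List (System.Process 𝔗)) (∈-processes : ∀ H → H ∈ processes)
  (search-⟶ : ∀ H m → Searchable (System._⟶[_]_ 𝔗 H m))
  where

  open System 𝔗
  open Game 𝔗 𝒱 H₀ φ
  open Config
  open Memory _≟ᴾ_ processes ∈-processes
  open DecMembership _≟ᴾ_ using () renaming (_∈?_ to _∈ᴾ?_)
  open DecMembership ℕ._≟_ using () renaming (_∈?_ to _∈ⱽ?_)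

  bound-occurrence : ∀ {C C′ Z} → formula C ≡ var Z → Move C C′ → Z ∈ binders φ
  bound-occurrence refl (loop b _ _) = binder⇒∈ (_ , _ , b)

  -- The binder of `Z` is unique, so the successor does not depend on which bound occurrence of `Z`
  -- is visited. Memories may therefore record processes alone.
  loop-target : ∀ {C C′ D D′ Z} → formula C ≡ var Z → formula D ≡ var Z → proc C ≡ proc D →
                Move C C′ → Move D D′ → C′ ≡ D′
  loop-target refl refl refl (loop b _ _) (loop b′ _ _)
    with refl ← binder-unique distinct (_ , _ , b) (_ , _ , b′) = refl

  unowned-unique : ∀ {C C₁ C₂} → owner (formula C) ≡ nothing → Move C C₁ → Move C C₂ → C₁ ≡ C₂
  unowned-unique _ unfold unfold = refl
  unowned-unique _ m₁@(loop _ _ _) m₂@(loop _ _ _) = loop-target refl refl refl m₁ m₂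

  search-move : ∀ C → Searchable (Move C)
  search-move (_⊢_ H {var Z} p) with loopAt? p
  ... | yes (κ , ψ , b , q , eq) = search-one (loop b q eq) λ m →
    loop-target refl refl refl m (loop b q eq)
  ... | no ¬loop = search-none λ { (loop b q eq) → ¬loop (_ , _ , b , q , eq) }
  search-move (_⊢_ H {~ ψ} p) = search-none λ ()
  search-move (_⊢_ H {ψ ∧ χ} p) =
    search-two left∧ right∧ λ { left∧ → inj₁ refl ; right∧ → inj₂ refl }
  search-move (_⊢_ H {ψ ∨ χ} p) =
    search-two left∨ right∨ λ { left∨ → inj₁ refl ; right∨ → inj₂ refl }
  search-move (_⊢_ H {⟨ a ⟩ ψ} p) f with search-⟶ H a (f ∘ step⟨⟩)
  ... | inj₁ (H′ , s , x) = inj₁ (_ , step⟨⟩ s , x)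
  ... | inj₂ q = inj₂ λ { (step⟨⟩ s) → q s }
  search-move (_⊢_ H {[ a ] ψ} p) f with search-⟶ H a (f ∘ step[])
  ... | inj₁ (H′ , s , x) = inj₁ (_ , step[] s , x)
  ... | inj₂ q = inj₂ λ { (step[] s) → q s }
  search-move (_⊢_ H {fix κ Z ψ} p) = search-one unfold λ { unfold → refl }

  move-or-terminal : ∀ C → ∃ (Move C) ⊎ Terminal C
  move-or-terminal C with search-move C {P = λ _ → ⊤} {Q = λ _ → ⊥} (λ _ → inj₁ tt)
  ... | inj₁ (C′ , m , _) = inj₁ (C′ , m)
  ... | inj₂ t = inj₂ t

  terminal-total : ∀ C → Terminal C → WinsTerminal Eve C ⊎ WinsTerminal Adam C
  terminal-total (_⊢_ H {var Z} p) t with 𝒱 Z H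
  ... | true = inj₁ refl
  ... | false = inj₂ refl
  terminal-total (_⊢_ H {~ ψ} p) t with Z , refl ← negated p with 𝒱 Z H
  ... | true = inj₂ refl
  ... | false = inj₁ refl
  terminal-total (_⊢_ H {ψ ∧ χ} p) t = contradiction left∧ t
  terminal-total (_⊢_ H {ψ ∨ χ} p) t = contradiction left∨ t
  terminal-total (_⊢_ H {⟨ _ ⟩ ψ} p) t = inj₂ tt
  terminal-total (_⊢_ H {[ _ ] ψ} p) t = inj₁ tt
  terminal-total (_⊢_ H {fix κ Z ψ} p) t = contradiction unfold t

  terminal-exclusive : ∀ C → WinsTerminal Eve C → ¬ WinsTerminal Adam C
  terminal-exclusive (_⊢_ H {var Z} p) e a with () ← trans (sym e) a
  terminal-exclusive (_⊢_ H {~ ψ} p) with Z , refl ← negated p =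
    λ e a → contradiction (trans (sym e) a) λ ()
  terminal-exclusive (_⊢_ H {ψ ∧ χ} p) ()
  terminal-exclusive (_⊢_ H {ψ ∨ χ} p) ()
  terminal-exclusive (_⊢_ H {⟨ _ ⟩ ψ} p) ()
  terminal-exclusive (_⊢_ H {[ _ ] ψ} p) _ ()
  terminal-exclusive (_⊢_ H {fix κ Z ψ} p) ()

  boundBy-exclusive : ∀ {Z} → BoundBy ν Z → ¬ BoundBy μ Z
  boundBy-exclusive (_ , b) (_ , b′) with () ← binder-unique distinct (_ , _ , b) (_ , _ , b′)

  boundBy-opponent : ∀ P {Z} → BoundBy (fixpointOf P) Z → ¬ BoundBy (fixpointOf (opponent P)) Z
  boundBy-opponent Eve = boundBy-exclusive
  boundBy-opponent Adam b b′ = boundBy-exclusive b′ b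

  boundBy-total : ∀ P {Z} → Z ∈ binders φ →
                  BoundBy (fixpointOf P) Z ⊎ BoundBy (fixpointOf (opponent P)) Z
  boundBy-total P Z∈ with ∈⇒binder φ Z∈
  boundBy-total Eve Z∈ | ν , b = inj₁ b
  boundBy-total Eve Z∈ | μ , b = inj₂ b
  boundBy-total Adam Z∈ | ν , b = inj₂ b
  boundBy-total Adam Z∈ | μ , b = inj₁ b

  History : Set
  History = Mem (binders φ)

  recordAt : Formula Label → Process → History → History
  recordAt (var Z) H m = visit Z H m
  recordAt _ H m = m

  update : History → Config → History
  update m C = recordAt (formula C) (proc C) m

  var-or-inert : ∀ ψ → (∃ λ Z → ψ ≡ var Z) ⊎ (∀ {H m} → recordAt ψ H m ≡ m)
  var-or-inert (var Z) = inj₁ (Z , refl)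
  var-or-inert (~ _) = inj₂ refl
  var-or-inert (_ ∧ _) = inj₂ refl
  var-or-inert (_ ∨ _) = inj₂ refl
  var-or-inert (⟨ _ ⟩ _) = inj₂ refl
  var-or-inert ([ _ ] _) = inj₂ refl
  var-or-inert (fix _ _ _) = inj₂ refl

  Repeats : History → Config → Var → Set
  Repeats m C Z = formula C ≡ var Z × proc C ∈ visited Z m

  repeats? : ∀ m C → Dec (∃ (Repeats m C))
  repeats? m (_⊢_ H {var Z} p) with H ∈ᴾ? visited Z m
  ... | yes H∈ = yes (Z , refl , H∈)
  ... | no H∉ = no λ { (_ , refl , H∈) → H∉ H∈ }
  repeats? m (_⊢_ H {~ _} p) = no λ ()
  repeats? m (_⊢_ H {_ ∧ _} p) = no λ ()
  repeats? m (_⊢_ H {_ ∨ _} p) = no λ ()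
  repeats? m (_⊢_ H {⟨ _ ⟩ _} p) = no λ ()
  repeats? m (_⊢_ H {[ _ ] _} p) = no λ ()
  repeats? m (_⊢_ H {fix _ _ _} p) = no λ ()

  -- A derivation is a winning strategy tree for `P` in the finite game; `every` covers both the
  -- opponent's configurations and the unowned ones. Since `m` is arbitrary, a free occurrence of a
  -- variable may satisfy `Repeats`; the move demanded by `cycle` keeps this apart from `stop`.
  data Wins (P : Player) (m : History) (C : Config) : Set where
    stop  : Terminal C → WinsTerminal P C → Wins P m C
    cycle : ∀ {Z} → ∃ (Move C) → Repeats m C Z → BoundBy (fixpointOf P) Z → Wins P m C
    pick  : ∀ {C′} → owner (formula C) ≡ just P → Move C C′ → Wins P (update m C) C′ →
            Wins P m C
    every : owner (formula C) ≢ just P → ∃ (Move C) → ¬ ∃ (Repeats m C) →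
            (∀ {C′} → Move C C′ → Wins P (update m C) C′) → Wins P m C

  _≪_ : Rel (History × ℕ) _
  _≪_ = ×-Lex _≡_ _⊏_ _<_

  move-size : ∀ {C C′} → Move C C′ → (∃ λ Z → formula C ≡ var Z × Z ∈ binders φ) ⊎
              size (formula C′) < size (formula C)
  move-size unfold = inj₂ (s≤s z≤n)
  move-size (loop b _ _) = inj₁ (_ , refl , binder⇒∈ (_ , _ , b))
  move-size left∨ = inj₂ (s≤s (ℕ.m≤m+n _ _))
  move-size right∨ = inj₂ (s≤s (ℕ.m≤n+m _ _))
  move-size left∧ = inj₂ (s≤s (ℕ.m≤m+n _ _))
  move-size right∧ = inj₂ (s≤s (ℕ.m≤n+m _ _))
  move-size (step⟨⟩ _) = inj₂ ℕ.≤-refl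
  move-size (step[] _) = inj₂ ℕ.≤-refl

  -- A move from a variable may enlarge the formula but records a fresh process, which decreases the
  -- memory; any other move keeps the memory and shrinks the formula.
  move-≪ : ∀ {m C C′} → Move C C′ → ¬ ∃ (Repeats m C) →
           (update m C , size (formula C′)) ≪ (m , size (formula C))
  move-≪ {m} {_⊢_ H {ψ} p} mv fresh with move-size mv
  ... | inj₁ (Z , refl , Z∈) = inj₁ (visit-⊏ m Z∈ λ H∈ → fresh (Z , refl , H∈))
  ... | inj₂ smaller with var-or-inert ψ
  -- Nothing is smaller than a variable, whose size is zero.
  ... | inj₁ (Z , refl) = contradiction smaller λ ()
  ... | inj₂ inert = inj₂ (inert , smaller)

  -- Backward induction: the owner wins if some successor is won by the owner, and otherwise the
  -- opponent wins all of them.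
  determined-acc : ∀ m C → Acc _≪_ (m , size (formula C)) → Wins Eve m C ⊎ Wins Adam m C
  determined-acc m C (acc rs) with move-or-terminal C
  ... | inj₂ t = [ inj₁ ∘ stop t , inj₂ ∘ stop t ]′ (terminal-total C t)
  ... | inj₁ mv with repeats? m C
  ... | yes (Z , r@(_ , H∈)) =
    [ inj₁ ∘ cycle mv r , inj₂ ∘ cycle mv r ]′ (boundBy-total Eve (visited⇒∈ m H∈))
  ... | no fresh = byOwner (owner (formula C)) refl
    where
    next : ∀ {C′} → Move C C′ → Wins Eve (update m C) C′ ⊎ Wins Adam (update m C) C′
    next {C′} m′ = determined-acc (update m C) C′ (rs (move-≪ m′ fresh))
    byOwner : ∀ o → owner (formula C) ≡ o → Wins Eve m C ⊎ Wins Adam m C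
    byOwner nothing eq = [ inj₁ ∘ forced , inj₂ ∘ forced ]′ (next (proj₂ mv))
      where
      forced : ∀ {P} → Wins P (update m C) (proj₁ mv) → Wins P m C
      forced w = every (λ eq′ → contradiction (trans (sym eq) eq′) λ ()) mv fresh
        λ m′ → subst (Wins _ _) (unowned-unique eq (proj₂ mv) m′) w
    byOwner (just Eve) eq with search-move C next
    ... | inj₁ (_ , m′ , w) = inj₁ (pick eq m′ w)
    ... | inj₂ ws = inj₂ (every (λ eq′ → contradiction (trans (sym eq) eq′) λ ()) mv fresh ws)
    byOwner (just Adam) eq with search-move C (swap ∘ next)
    ... | inj₁ (_ , m′ , w) = inj₂ (pick eq m′ w)
    ... | inj₂ ws = inj₁ (every (λ eq′ → contradiction (trans (sym eq) eq′) λ ()) mv fresh ws)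

  determined : ∀ P m C → Wins P m C ⊎ Wins (opponent P) m C
  determined P m C with P | determined-acc m C (×-wellFounded ⊏-wellFounded <-wellFounded _)
  ... | Eve | w = w
  ... | Adam | w = swap w

  var-unowned : ∀ {C Z} {P : Player} → formula C ≡ var Z → owner (formula C) ≢ just P
  var-unowned refl ()

  -- The two trees are played against each other, `every` answering `pick`, until a common end that
  -- would be won by both.
  exclusive : ∀ {m C} → Wins Eve m C → ¬ Wins Adam m C
  exclusive (stop _ e) (stop _ a) = terminal-exclusive _ e a
  exclusive (stop t _) (cycle (_ , mv) _ _) = t mv
  exclusive (stop t _) (pick _ mv _) = t mv
  exclusive (stop t _) (every _ (_ , mv) _ _) = t mv
  exclusive (cycle (_ , mv) _ _) (stop t _) = t mv
  exclusive (cycle _ (refl , _) b) (cycle _ (refl , _) b′) = boundBy-exclusive b b′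
  exclusive (cycle _ (refl , _) _) (pick () _ _)
  exclusive (cycle _ r _) (every _ _ fresh _) = fresh (_ , r)
  exclusive (pick _ mv _) (stop t _) = t mv
  exclusive (pick () _ _) (cycle _ (refl , _) _)
  exclusive (pick e _ _) (pick a _ _) = contradiction (trans (sym e) a) λ ()
  exclusive (pick _ mv w) (every _ _ _ ws) = exclusive w (ws mv)
  exclusive (every _ (_ , mv) _ _) (stop t _) = t mv
  exclusive (every _ _ fresh _) (cycle _ r _) = fresh (_ , r)
  exclusive (every _ _ _ ws) (pick _ mv w) = exclusive (ws mv) w
  exclusive (every _ (_ , mv) _ ws) (every _ _ _ ws′) = exclusive (ws mv) (ws′ mv)

  exclusive′ : ∀ P {m C} → Wins P m C → ¬ Wins (opponent P) m C
  exclusive′ Eve = exclusive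
  exclusive′ Adam w w′ = exclusive w′ w

  -- From the finite game to winning strategies in the infinite one

  -- Where a cycle has been closed at H ⊢ Z in the favour of P, the play
  -- resumes with the memory of the first visit.
  Resumable : Player → History → Set
  Resumable P m = ∀ {Z C C′} → BoundBy (fixpointOf P) Z → Repeats m C Z → Move C C′ →
                  Wins P (visit Z (proc C) m) C′

  resumable-empty : ∀ P → Resumable P empty
  resumable-empty P {Z} _ (_ , H∈) _ rewrite visited-empty {Z} (binders φ) = contradiction H∈ λ ()

  -- By `visit-visit`, returning to an older process restores the memory that `res` already handles,
  -- and returning to the one just recorded restores the present memory, with the present successor
  -- by `loop-target`.
  resumable-visit : ∀ {P m Z C C′} → formula C ≡ var Z → Move C C′ →
                    Wins P (visit Z (proc C) m) C′ → Resumable P m →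
                    Resumable P (visit Z (proc C) m)
  resumable-visit {m = m} C≡Z mv w res b (D≡Y , H∈) mv′ with visit-visit m H∈
  ... | eq , inj₂ H∈m rewrite eq = res b (D≡Y , H∈m) mv′
  ... | eq , inj₁ (refl , H≡) rewrite eq | H≡ | loop-target D≡Y C≡Z H≡ mv′ mv = w

  resumable-update : ∀ {P m C C′} → Move C C′ →
                     Wins P (update m C) C′ → Resumable P m → Resumable P (update m C)
  resumable-update {m = m} {_⊢_ H {ψ} p} mv w res with var-or-inert ψ
  ... | inj₁ (Z , refl) = resumable-visit {m = m} refl mv w res
  ... | inj₂ inert rewrite inert {H} {m} = res

  history : List Config → History
  history [] = empty
  history (C ∷ h) = update (history h) C

  Invariant : Player → History → Config → Set
  Invariant P m C = Wins P m C × Resumable P m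

  data Advance (P : Player) (m : History) (C : Config) : Set where
    own   : ∀ {C′} → owner (formula C) ≡ just P → Move C C′ → Wins P (update m C) C′ →
            Advance P m C
    other : owner (formula C) ≢ just P → (∀ {C′} → Move C C′ → Wins P (update m C) C′) →
            Advance P m C

  advance : ∀ {P m C C′} → Move C C′ → Invariant P m C → Advance P m C
  advance mv (stop t _ , _) = contradiction mv t
  -- Here the finite game is over while the play goes on; resumability supplies the win at the next
  -- configuration.
  advance _ (cycle mv r@(refl , _) b , res) = other (λ ()) (res b r)
  advance _ (pick eq mv w , _) = own eq mv w
  advance _ (every neq _ _ ws , _) = other neq ws

  invariant-terminal : ∀ {P m C} → Invariant P m C → Terminal C → WinsTerminal P C
  invariant-terminal (stop _ w , _) _ = w
  invariant-terminal (cycle (_ , mv) _ _ , _) t = contradiction mv t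
  invariant-terminal (pick _ mv _ , _) t = contradiction mv t
  invariant-terminal (every _ (_ , mv) _ _ , _) t = contradiction mv t

  module _ (P : Player) where

    select : History → Config → Config
    select m C with search-move C (λ {C′} _ → determined P (update m C) C′)
    ... | inj₁ (C′ , _) = C′
    -- With no winning successor any legal move will do; `C` is a placeholder when there is none.
    ... | inj₂ _ = [ proj₁ , (λ _ → C) ]′ (move-or-terminal C)

    select-legal : ∀ m C → ∃ (Move C) → Move C (select m C)
    select-legal m C mv with search-move C (λ {C′} _ → determined P (update m C) C′)
    ... | inj₁ (_ , mv′ , _) = mv′
    ... | inj₂ _ with move-or-terminal C
    ... | inj₁ (_ , mv′) = mv′
    ... | inj₂ t = contradiction (proj₂ mv) t

    -- The search may return another successor than `C′`, but it cannot fail: by `exclusive′` the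
    -- opponent does not win at `C′`.
    select-wins : ∀ {m C C′} → Move C C′ → Wins P (update m C) C′ →
                  Wins P (update m C) (select m C)
    select-wins {m} {C} mv w with search-move C (λ {C′} _ → determined P (update m C) C′)
    ... | inj₁ (_ , _ , w′) = w′
    ... | inj₂ ws = contradiction (ws mv) (exclusive′ P w)

    strategy : Strategy P
    strategy = record
      { choose = λ h → select (history h)
      ; legal = λ h C _ → select-legal (history h) C
      }

    module _ (wins : Wins P empty start) where

      invariant : ∀ {h C} → PlayFollowing strategy h C → Invariant P (history h) C
      invariant begin = wins , resumable-empty P
      invariant (extend {h} {C} {C′} play mv follows) = w , resumable-update mv w res
        where
        res = proj₂ (invariant play)
        w : Wins P (update (history h) C) C′
        w with advance mv (invariant play)
        ... | own eq mv′ w′ rewrite follows eq = select-wins mv′ w′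
        ... | other _ ws = ws mv

      module _ (π : ℕ → Config)
               (play : ∀ n → PlayFollowing strategy (applyDownFrom π n) (π n)) where

        moves : ∀ n → Move (π n) (π (suc n))
        moves n with extend _ mv _ ← play (suc n) = mv

        memory : ℕ → History
        memory n = history (applyDownFrom π n)

        -- A repetition on a play kept inside the invariant can only be a `cycle`, and that requires
        -- a variable bound by the fixpoint of `P`.
        unrepeated : ∀ {Z} → BoundBy (fixpointOf (opponent P)) Z → ∀ n → Occurs π Z n →
                     proc (π n) ∉ visited Z (memory n)
        unrepeated b n occ H∈ with proj₁ (invariant (play n))
        ... | stop t _ = t (moves n)
        ... | cycle _ (occ′ , _) b′ with refl ← trans (sym occ) occ′ =
          boundBy-opponent P b′ b
        ... | pick eq _ _ = var-unowned {π n} occ eq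
        ... | every _ _ fresh _ = fresh (_ , occ , H∈)

        free : Var → ℕ → ℕ
        free Z n = room (visited Z (memory n))

        free-< : ∀ {Z} → BoundBy (fixpointOf (opponent P)) Z → ∀ n → Occurs π Z n →
                 free Z (suc n) < free Z n
        free-< {Z} b n occ with H∉ ← unrepeated b n occ rewrite occ
          | visited-visit {k = proc (π n)} (memory n) (binder⇒∈ (_ , b)) | push-∉ H∉ = room-∷ H∉

        -- The list of such a `Z` is never cut back, having no repetitions, and visits to later
        -- variables leave it alone. Only a visit to an earlier variable could give room back.
        free-≤ : ∀ {Z} → BoundBy (fixpointOf (opponent P)) Z → ∀ n →
                 (∀ {Y} → Y ∈ before Z (binders φ) → ¬ Occurs π Y n) →
                 free Z (suc n) ℕ.≤ free Z n
        free-≤ {Z} b n none with var-or-inert (formula (π n))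
        ... | inj₂ inert rewrite inert {proc (π n)} {memory n} = ℕ.≤-refl
        ... | inj₁ (Y , occ) with Y ≟ Z
        ... | yes refl = ℕ.<⇒≤ (free-< b n occ)
        ... | no Y≢Z rewrite occ
          | visited-visit-other {k = proc (π n)} (memory n) (λ Y∈ → none Y∈ refl) Y≢Z = ℕ.≤-refl

        -- The outermost variable cannot be bound by the opponent's fixpoint:
        -- its list of processes would grow for ever.
        wins-infinite : WinsInfinite P π
        wins-infinite Z (inf , encloses) with Z ∈ⱽ? binders φ
        ... | no Z∉ = contradiction
          (0 , λ n _ occ → Z∉ (bound-occurrence occ (moves n))) inf
        ... | yes Z∈ with boundBy-total P Z∈
        ... | inj₁ b = b
        ... | inj₂ b = ⊥-elim (eventually-never (Occurs π) (before Z (binders φ)) finite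
          λ (N , never) → descent (free Z) N
            (λ n N≤n → free-≤ b n (λ Y∈ → never Y∈ n N≤n)) (λ n _ → free-< b n) inf)
          where
          -- The binder of every recurring variable lies at or below that of `Z`, hence not earlier
          -- in the preorder.
          finite : ∀ {Y} → Y ∈ before Z (binders φ) → ¬ Inf (Occurs π Y)
          finite {Y} Y∈ infY with _ , _ , _ , _ , z , y ← encloses Y infY =
            enclosed⇒∉before distinct z (binder⇒∈ (_ , _ , y)) Y∈

      winning : Winning strategy
      winning = record
        { finite = λ play t → invariant-terminal (invariant play) t
        ; infinite = wins-infinite
        }

  determinacy : ∃ HasWinningStrategy
  determinacy with determined Eve empty start
  ... | inj₁ w = Eve , strategy Eve , winning Eve w
  ... | inj₂ w = Adam , strategy Adam , winning Adam w

  -- Existence of the outermost variable and uniqueness of the winner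

  Under : ∀ {ψ} → Sub φ ψ → Config → Set
  Under b C = ∃ λ q → sub C ≡ b ◅◅ q

  -- Binders above a common occurrence are nested, and the preorder lists a properly enclosing one
  -- first.
  inside-or-before : ∀ {κ Z ψ κ′ Y χ} (b : Sub φ (fix κ Z ψ)) (b′ : Sub φ (fix κ′ Y χ)) →
    ∀ {ρ} {q : Sub (fix κ Z ψ) ρ} {q′} → b ◅◅ q ≡ b′ ◅◅ q′ →
    (∃ λ r → b′ ≡ b ◅◅ r) ⊎ Y ∈ before Z (binders φ)
  inside-or-before b b′ eq with ◅◅-comparable b b′ eq
  ... | inj₁ below = inj₁ below
  ... | inj₂ (ε , eq′) = inj₁
    (ε , trans (sym (◅◅-identityʳ b′)) (trans (sym eq′) (sym (◅◅-identityʳ b))))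
  ... | inj₂ ((fix-body ◅ r) , _) = inj₂ (encloses⇒∈before distinct b′ (binder⇒∈ (_ , _ , r)))
  ... | inj₂ ((fix-var ◅ (() ◅ _)) , _)

  under-child : ∀ {ψ χ ρ} (b : Sub φ ψ) {p : Sub φ χ} (i : χ ▸ ρ) →
                (∃ λ q → p ≡ b ◅◅ q) → ∃ λ q → p at i ≡ b ◅◅ q
  under-child b i (q , refl) = q ◅◅ (i ◅ ε) , ◅◅-assoc b q (i ◅ ε)

  -- Only a loop can leave the subtree at `b`, and then it goes to a binder properly above `b`,
  -- hence from a variable earlier than `Z`.
  under-move : ∀ {κ Z ψ C C′} (b : Sub φ (fix κ Z ψ)) → Move C C′ →
               (∀ {Y} → Y ∈ before Z (binders φ) → formula C ≢ var Y) →
               Under b C → Under b C′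
  under-move b unfold _ u = under-child b fix-var u
  under-move b (loop b′ q′ eq) none (q , eq′) with inside-or-before b b′ (trans (sym eq′) eq)
  ... | inj₁ below = under-child b fix-body below
  ... | inj₂ Y∈ = contradiction refl (none Y∈)
  under-move b left∨ _ u = under-child b ∨▸ˡ u
  under-move b right∨ _ u = under-child b ∨▸ʳ u
  under-move b left∧ _ u = under-child b ∧▸ˡ u
  under-move b right∧ _ u = under-child b ∧▸ʳ u
  under-move b (step⟨⟩ _) _ u = under-child b ⟨⟩▸ u
  under-move b (step[] _) _ u = under-child b []▸ u

  under-loop : ∀ {κ Z ψ C C′} (b : Sub φ (fix κ Z ψ)) → formula C ≡ var Z → Move C C′ → Under b C′
  under-loop b refl (loop b′ _ _) with refl ← binder-unique distinct (_ , _ , b) (_ , _ , b′) =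
    (fix-body ◅ ε) , refl

  under-occurrence : ∀ {κ Z ψ C C′ Y} (b : Sub φ (fix κ Z ψ)) → Under b C →
                     formula C ≡ var Y → Move C C′ →
                     Y ∈ Z ∷ binders ψ ⊎ Y ∈ before Z (binders φ)
  under-occurrence b (q , eq) refl (loop b′ _ eq′) with inside-or-before b b′ (trans (sym eq) eq′)
  ... | inj₁ (r , _) = inj₁ (binder⇒∈ (_ , _ , r))
  ... | inj₂ Y∈ = inj₂ Y∈

  module _ (π : ℕ → Config) (moves : ∀ n → Move (π n) (π (suc n))) where

    stays-under : ∀ {κ Z ψ n} (b : Sub φ (fix κ Z ψ)) → Occurs π Z n →
                  (∀ {Y} → Y ∈ before Z (binders φ) → ∀ m → n ℕ.≤ m → ¬ Occurs π Y m) →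
                  ∀ {m} → n ℕ.<′ m → Under b (π m)
    stays-under b occ never ℕ.≤′-refl = under-loop b occ (moves _)
    stays-under b occ never (ℕ.≤′-step n<m) = under-move b (moves _)
      (λ Y∈ → never Y∈ _ (ℕ.<⇒≤ (ℕ.≤′⇒≤ n<m))) (stays-under b occ never n<m)

    -- The recurring variable that is first in the preorder encloses the others, because the play is
    -- eventually confined below its binder.
    outermost : ∀ {Z} → Z ∈ binders φ → Inf (Occurs π Z) →
                (∀ {Y} → Y ∈ before Z (binders φ) → ¬ Inf (Occurs π Y)) → Outermost π Z
    outermost {Z} Z∈ inf earlier with κ , ψ , b ← ∈⇒binder φ Z∈ = inf , encloses
      where
      encloses : ∀ Y → Inf (Occurs π Y) → Encloses Z Y
      encloses Y infY with Y ∈ⱽ? (Z ∷ binders ψ)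
      ... | yes Y∈ with κ′ , ψ′ , b′ ← ∈⇒binder (fix κ Z ψ) Y∈ = κ , ψ , κ′ , ψ′ , b , b′
      -- Past `N` no earlier variable occurs, so a visit to `Z` at `n` confines the play below `b`,
      -- where `Y` can no longer occur; `suc n` then bounds the visits to `Y`.
      ... | no Y∉ = ⊥-elim (eventually-never (Occurs π) _ earlier λ (N , never) →
        inf (N , λ n N≤n occ → infY (suc n , λ m n<m occY →
          [ Y∉ , (λ Y∈ → never Y∈ m (ℕ.≤-trans N≤n (ℕ.<⇒≤ n<m)) occY) ]′
            (under-occurrence b
              (stays-under b occ (λ Y∈ m n≤m → never Y∈ m (ℕ.≤-trans N≤n n≤m)) (ℕ.≤⇒≤′ n<m))
              occY (moves m)))))

    outermost-exists : ¬ ¬ ∃ (Outermost π)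
    outermost-exists k = first-infinite (Occurs π) (binders φ) λ where
      (inj₁ (Z , Z∈ , inf , earlier)) → k (Z , outermost Z∈ inf earlier)
      (inj₂ finite) → eventually-never (Occurs π) (binders φ) finite λ (N , never) →
        let
          decreases : ∀ n → N ℕ.≤ n → size (formula (π (suc n))) < size (formula (π n))
          decreases n N≤n = [ (λ (Z , occ , Z∈) → contradiction occ (never Z∈ n N≤n)) , id ]′
            (move-size (moves n))
        in
        -- If no bound variable recurs, the formula shrinks at every step from `N` on; the recurring
        -- property is taken to be the trivial one.
        descent (size ∘ formula ∘ π) N (λ n N≤n → ℕ.<⇒≤ (decreases n N≤n))
          (λ n N≤n _ → decreases n N≤n) λ (n , never) → never n ℕ.≤-refl tt

  module _ (e : Strategy Eve) (e-wins : Winning e) (a : Strategy Adam) (a-wins : Winning a) where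

    open Winning

    record Position : Set where
      field
        {past}  : List Config
        current : Config
        by-e    : PlayFollowing e past current
        by-a    : PlayFollowing a past current
    open Position

    reply : ∀ {C} h → ∃ (Move C) → ∃ λ C′ → Move C C′ ×
            (owner (formula C) ≡ just Eve → C′ ≡ Strategy.choose e h C) ×
            (owner (formula C) ≡ just Adam → C′ ≡ Strategy.choose a h C)
    reply {C} h mv with owner (formula C) in eq
    ... | nothing = proj₁ mv , proj₂ mv , (λ ()) , (λ ())
    ... | just Eve = _ , Strategy.legal e h C eq mv , (λ _ → refl) , (λ ())
    ... | just Adam = _ , Strategy.legal a h C eq mv , (λ ()) , (λ _ → refl)

    -- The joint play never ends, since its last configuration would be won by both players.
    continue : Position → Position
    continue x with move-or-terminal (current x)
    ... | inj₁ mv with _ , mv′ , eq , aq ← reply (past x) mv = record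
      { by-e = extend (by-e x) mv′ eq ; by-a = extend (by-a x) mv′ aq }
    ... | inj₂ t = contradiction (finite a-wins (by-a x) t)
      (terminal-exclusive _ (finite e-wins (by-e x) t))

    position : ℕ → Position
    position zero = record { by-e = begin ; by-a = begin }
    position (suc n) = continue (position n)

    joint-play : ℕ → Config
    joint-play = current ∘ position

    past-continue : ∀ x → past (continue x) ≡ current x ∷ past x
    past-continue x with move-or-terminal (current x)
    ... | inj₁ mv = refl
    ... | inj₂ t = contradiction (finite a-wins (by-a x) t)
      (terminal-exclusive _ (finite e-wins (by-e x) t))

    -- Brings the accumulated past into the form in which `infinite` expects the play.
    past-position : ∀ n → past (position n) ≡ applyDownFrom joint-play n
    past-position zero = refl
    past-position (suc n) =
      trans (past-continue (position n)) (cong (joint-play n ∷_) (past-position n))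

    joint-by-e : ∀ n → PlayFollowing e (applyDownFrom joint-play n) (joint-play n)
    joint-by-e n =
      subst (λ h → PlayFollowing e h (joint-play n)) (past-position n) (by-e (position n))

    joint-by-a : ∀ n → PlayFollowing a (applyDownFrom joint-play n) (joint-play n)
    joint-by-a n =
      subst (λ h → PlayFollowing a h (joint-play n)) (past-position n) (by-a (position n))

    not-both : ⊥
    not-both = outermost-exists joint-play
      (λ n → case joint-by-e (suc n) of λ { (extend _ mv _) → mv })
      λ (Z , out) → boundBy-exclusive
        (infinite e-wins joint-play joint-by-e Z out)
        (infinite a-wins joint-play joint-by-a Z out)

  winner-unique : ∀ {P Q} → HasWinningStrategy P → HasWinningStrategy Q → P ≡ Q
  winner-unique {Eve} {Eve} _ _ = refl
  winner-unique {Adam} {Adam} _ _ = refl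
  winner-unique {Eve} {Adam} (e , e-wins) (a , a-wins) = ⊥-elim (not-both e e-wins a a-wins)
  winner-unique {Adam} {Eve} (a , a-wins) (e , e-wins) = ⊥-elim (not-both e e-wins a a-wins)

  winner-decidable : ∀ P → Dec (HasWinningStrategy P)
  winner-decidable P with determinacy
  winner-decidable Eve | Eve , w = yes w
  winner-decidable Adam | Adam , w = yes w
  winner-decidable Eve | Adam , w = no λ w′ → case winner-unique w w′ of λ ()
  winner-decidable Adam | Eve , w = no λ w′ → case winner-unique w w′ of λ ()

theorem8 : (𝔗 : FiniteTSI) →
    let open System 𝔗 in
    (𝒱 : Valuation) (φ : Formula Label) →
    WellFormed φ → PositiveNormalForm φ →
    let open Game 𝔗 𝒱 initial φ in
    (∀ (P : Player) → Dec (HasWinningStrategy P)) ×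
    ∃! _≡_ HasWinningStrategy
theorem8 𝔗 𝒱 φ _ pnf =
  winner-decidable , proj₁ determinacy , proj₂ determinacy , winner-unique (proj₂ determinacy)
  where
  open SystemProperties 𝔗
  open PositiveNormalForm pnf
  open GameProperties 𝔗 𝒱 (System.initial 𝔗) φ distinct-binders negation-on-variables
    _≟ᴾ_ processes ∈-processes search-⟶
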